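{- (Selection adequacy) For any program $M:\sigma$ we have $\mathcal S[\![M]\!](0)=[\![\mathrm{Op}_s(M)]\!]_T$, where $0$ is the constantly $0$ reward function on $\mathcal S[\![\sigma]\!]$.
   Context: **Language.** Fix base types $b$, including $\mathtt{Bool}$ and $\mathtt{Rew}$; for each $b$ a set of constants $c:b$ (including $\mathtt{tt},\mathtt{ff}:\mathtt{Bool}$, $0:\mathtt{Rew}$); and function symbols $f:b_1\ldots b_m\to b$, including $=_b\,:b\,b\to\mathtt{Bool}$ for each $b$, $+:\mathtt{Rew}\,\mathtt{Rew}\to\mathtt{Rew}$, $\oplus_p:\mathtt{Rew}\,\mathtt{Rew}\to\mathtt{Rew}$ ($p\in[0,1]$) and $\le\,:\mathtt{Rew}\,\mathtt{Rew}\to\mathtt{Bool}$. Types: $\sigma::=b\mid\mathtt{Unit}\mid\sigma\times\sigma\mid\sigma\to\sigma$. Terms: $M::=x\mid c\mid f(M_1,\dots,M_m)\mid\mathtt{if}\,L\,\mathtt{then}\,M\,\mathtt{else}\,N\mid M\,\mathtt{or}\,N\mid N\cdot M\mid M+_pN\ (p\in[0,1])\mid *\mid\langle M,N\rangle\mid\mathtt{fst}(M)\mid\mathtt{snd}(M)\mid\lambda x{:}\sigma.M\mid MN$, up to $\alpha$-equivalence, with standard simple typing; $M\,\mathtt{or}\,N$ and $M+_pN$ have type $\sigma$ when $M,N:\sigma$, and $N\cdot M:\sigma$ when $N:\mathtt{Rew}$, $M:\sigma$. Programs are closed well-typed terms. Values (closed): $V::=c\mid *\mid\langle V,W\rangle\mid\lambda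 x{:}\sigma.M$; $\mathrm{Val}_\sigma$ is the set of values of type $\sigma$. Effect values: $E::=V\mid E_1\,\mathtt{or}\,E_2\mid c\cdot E\mid E_1+_pE_2$ ($c:\mathtt{Rew}$). **Ordinary operational semantics.** Evaluation contexts (closed): $\mathcal E::=[\,]\mid f(c_1,\dots,c_{k-1},\mathcal E,M_{k+1},\dots,M_m)\mid\mathtt{if}\,\mathcal E\,\mathtt{then}\,M\,\mathtt{else}\,N\mid\mathcal E\cdot M\mid\langle\mathcal E,N\rangle\mid\langle V,\mathcal E\rangle\mid\mathtt{fst}(\mathcal E)\mid\mathtt{snd}(\mathcal E)\mid\mathcal EN\mid(\lambda x{:}\sigma.M)\mathcal E$. Constants $\mathrm{val}_f(c_1,\dots,c_m):b$ are given for all $f$ and $c_i:b_i$, with $\mathrm{val}_{=_b}(c,c')=\mathtt{tt}$ if $c=c'$, else $\mathtt{ff}$. Steps $\mathcal E[Q]\to\mathcal E[Q']$ arise from: $f(c_1,\dots,c_m)\to\mathrm{val}_f(c_1,\dots,c_m)$; $\mathtt{if}\,\mathtt{tt}\,\mathtt{then}\,M\,\mathtt{else}\,N\to M$; $\mathtt{if}\,\mathtt{ff}\,\mathtt{then}\,M\,\mathtt{else}\,N\to N$; $\mathtt{fst}\langle V,W\rangle\to V$; $\mathtt{snd}\langle V,W\rangle\to W$; $(\lambda x{:}\sigma.M)V\to M[V/x]$. Evaluation is deterministic and terminating, and each program $M:\sigma$ has an effect value $\mathrm{Op}(M):\sigma$ determined by $\mathrm{Op}(V)=V$; $\mathrm{Op}(M)=\mathrm{Op}(M')$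 if $M\to M'$; $\mathrm{Op}(\mathcal E[M_1\,\mathtt{or}\,M_2])=\mathrm{Op}(\mathcal E[M_1])\,\mathtt{or}\,\mathrm{Op}(\mathcal E[M_2])$; $\mathrm{Op}(\mathcal E[M_1+_pM_2])=\mathrm{Op}(\mathcal E[M_1])+_p\mathrm{Op}(\mathcal E[M_2])$; $\mathrm{Op}(\mathcal E[c\cdot M_1])=c\cdot\mathrm{Op}(\mathcal E[M_1])$. **Rewards and interpretation.** A barycentric algebra is a set with binary operations $+_p$ ($p\in[0,1]$) such that $x+_1y=x$, $x+_px=x$, $x+_py=y+_{1-p}x$ and $(x+_py)+_qz=x+_{pq}(y+_{(1-p)q/(1-pq)}z)$ for $p,q<1$; finite convex combinations $\sum_ip_ix_i$ are then defined as usual. $R$ is a set with a barycentric algebra structure $+_p$, a commutative monoid structure $(+,0)$ with $r+(s+_ps')=(r+s)+_p(r+s')$, and a total order $\le$ such that for all $r,s,t$: $r\le s\iff r+t\le s+t$, and $r\le s\iff r+_pt\le s+_pt$ for $p\in(0,1)$. Given are nonempty sets $[\![b]\!]$ with $[\![\mathtt{Bool}]\!]=\{0,1\}$, $[\![\mathtt{Rew}]\!]=R$; elements $[\![c]\!]\in[\![b]\!]$ for $c:b$ with $[\![\mathtt{tt}]\!]=1$, $[\![\mathtt{ff}]\!]=0$, $[\![0]\!]=0$, distinct constants of the same type having distinct denotations, and $[\![c]\!]\ne0$ for some $c:\mathtt{Rew}$; and functions $[\![f]\!]:[\![b_1]\!]\times\cdots\times[\![b_m]\!]\to[\![b]\!]$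 with $[\![+]\!],[\![\oplus_p]\!],[\![\le]\!]$ the addition, the operation $+_p$ and the (characteristic function of the) order of $R$, and $[\![f]\!]([\![c_1]\!],\dots,[\![c_m]\!])=[\![\mathrm{val}_f(c_1,\dots,c_m)]\!]$. A barycentric $R$-module is a barycentric algebra with an action of $R$ ($0\cdot x=x$, $r\cdot(s\cdot x)=(r+s)\cdot x$) such that $r\cdot(x+_py)=r\cdot x+_pr\cdot y$; $R$ is one via $r\cdot s=r+s$. $DW(X)$ is the set of finitely supported probability distributions $\sum_ip_i\langle r_i,x_i\rangle$ on $R\times X$; it is the free barycentric $R$-module on $X$, with $r\cdot\sum_ip_i\langle r_i,x_i\rangle=\sum_ip_i\langle r+r_i,x_i\rangle$ and the usual $+_p$. The expected reward is $\mathbf E(\sum_ip_i\langle r_i,x_i\rangle)=\sum_ip_ir_i$. **Selection operational semantics.** Strategies: a value has the single strategy $*$; those of $E_1\,\mathtt{or}\,E_2$ are $1s$ ($s\in\mathrm{Str}(E_1)$) and $2s$ ($s\in\mathrm{Str}(E_2)$); those of $c\cdot E$ are those of $E$; those of $E_1+_pE_2$ are pairs $(s_1,s_2)$, $s_i\in\mathrm{Str}(E_i)$. Outcomes: $\mathrm{Out}(*,V)=\langle0,V\rangle$ (Dirac); $\mathrm{Out}(is,E_1\,\mathtt{or}\,E_2)=\mathrm{Out}(s,E_i)$; $\mathrm{Out}(s,c\cdot E)=[\![c]\!]\cdot\mathrm{Out}(s,E)$; $\mathrm{Out}((s_1,s_2),E_1+_pE_2)=p\,\mathrm{Out}(s_1,E_1)+(1-p)\,\mathrm{Out}(s_2,E_2)$.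 $\mathrm{Rew}(s,E)=\mathbf E(\mathrm{Out}(s,E))$. Strategies are totally ordered: on $E_1\,\mathtt{or}\,E_2$ all $1s$ precede all $2s'$, each group ordered as in $E_1$, resp. $E_2$; on $c\cdot E$ as in $E$; on $E_1+_pE_2$ lexicographically. $\mathrm{Op}_s(M)=\mathrm{Out}(s_{\rm opt},\mathrm{Op}(M))\in DW(\mathrm{Val}_\sigma)$, where $s_{\rm opt}$ is the least strategy of $\mathrm{Op}(M)$ maximizing $\mathrm{Rew}(s,\mathrm{Op}(M))$. **Auxiliary monad.** $T$ is a monad on sets (unit $\eta_T$, Kleisli extension $(-)^{\dagger_T}$), with operations $\cdot_T:R\times T(X)\to T(X)$ and $+_p:T(X)^2\to T(X)$ for all sets $X$ commuting with all Kleisli extensions (i.e. $T$-algebraic operations, induced by generic effects $R\to T(\{0\})$ and elements of $T(\{0,1\})$), and a $T$-algebra $\alpha_T:T(R)\to R$, such that (A1) each $T(X)$ is a barycentric $R$-module, and (A2) $\alpha_T(r\cdot u)=r+\alpha_T(u)$, $\alpha_T(u+_pv)=\alpha_T(u)+_p\alpha_T(v)$. **Denotational semantics.** $S(X)=(X\to R)\to T(X)$. For $F\in S(X)$, $\gamma:X\to R$ put $\mathbf R(F|\gamma)=\alpha_T(T(\gamma)(F(\gamma)))$. $S$ is a monad with $\eta(x)(\gamma)=\eta_T(x)$ and, for $f:X\to S(Y)$, $f^\dagger(F)(\gamma)=(\lambda x.\,f(x)(\gamma))^{\dagger_T}\big(F(\lambda x.\,\mathbf R(f(x)|\gamma))\big)$.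 Operations: $(G_0\,\mathtt{or}\,G_1)(\gamma)=G_0(\gamma)$ if $\mathbf R(G_0|\gamma)\ge\mathbf R(G_1|\gamma)$, else $G_1(\gamma)$; $(r\cdot G)(\gamma)=r\cdot_TG(\gamma)$; $(F+_pG)(\gamma)=F(\gamma)+_pG(\gamma)$. Types: $\mathcal S[\![b]\!]=[\![b]\!]$, $\mathcal S[\![\mathtt{Unit}]\!]=\{*\}$, $\mathcal S[\![\sigma\times\tau]\!]=\mathcal S[\![\sigma]\!]\times\mathcal S[\![\tau]\!]$, $\mathcal S[\![\sigma\to\tau]\!]=\mathcal S[\![\sigma]\!]\to S(\mathcal S[\![\tau]\!])$. A term $\Gamma\vdash M:\sigma$ denotes $\mathcal S[\![M]\!]:\mathcal S[\![\Gamma]\!]\to S(\mathcal S[\![\sigma]\!])$ by the standard left-to-right call-by-value monadic semantics: variables, constants, $*$ and abstractions via $\eta$ ($\mathcal S[\![\lambda x{:}\sigma.M]\!](\rho)=\eta(a\mapsto\mathcal S[\![M]\!](\rho,a))$); pairs, projections, applications, function symbols and conditions of conditionals by sequencing arguments left to right with Kleisli extension; $\mathtt{or}$ and $+_p$ by applying the corresponding operation of $S$ to the denotations of the arguments; $\mathcal S[\![N\cdot M]\!](\rho)=(r\mapsto r\cdot\mathcal S[\![M]\!](\rho))^\dagger(\mathcal S[\![N]\!](\rho))$. For programs $\mathcal S[\![M]\!]$ is regarded as an element of $S(\mathcal S[\![\sigma]\!])$. Values $V:\sigma$ have a pure semantics $\mathcal S_p[\![V]\!]\in\mathcal S[\![\sigma]\!]$: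 $\mathcal S_p[\![c]\!]=[\![c]\!]$, $\mathcal S_p[\![*]\!]=*$, $\mathcal S_p[\![\langle V,V'\rangle]\!]=\langle\mathcal S_p[\![V]\!],\mathcal S_p[\![V']\!]\rangle$, $\mathcal S_p[\![\lambda x{:}\tau.N]\!]=\mathcal S[\![x{:}\tau\vdash N]\!]$. For $\mu=\sum_{i=1}^np_i\langle r_i,V_i\rangle\in DW(\mathrm{Val}_\sigma)$ put $[\![\mu]\!]_T=\sum_{i=1}^np_i\,\big(r_i\cdot_T\eta_T(\mathcal S_p[\![V_i]\!])\big)\in T(\mathcal S[\![\sigma]\!])$. -}

module Defs where

open import Algebra.Bundles using (CommutativeRing)
open import Algebra.Structures using (IsCommutativeRing; IsCommutativeMonoid)
open import Data.Bool.Base using (Bool; true; false; if_then_else_)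
open import Data.Empty using (⊥; ⊥-elim)
open import Data.List.Base using (List; []; _∷_; _++_; map)
open import Data.List.Membership.Propositional using (_∈_)
open import Data.List.NonEmpty.Base as List⁺ using (List⁺; _∷_; _⁺++⁺_)
open import Data.List.Relation.Unary.All as All using (All; []; _∷_)
open import Data.List.Relation.Unary.Any using (here; there)
open import Data.Product.Base using (∃; ∃-syntax; _×_; _,_; proj₁; proj₂)
open import Data.Sum.Base using (_⊎_; inj₁; inj₂)
open import Data.Unit.Base using (⊤; tt)
open import Function.Base using (_∘_; id)
open import Function.Bundles using (_⇔_)
open import Level using (0ℓ)
open import Relation.Binary.PropositionalEquality
  using (_≡_; _≢_; refl; sym; trans; cong; cong₂; subst; subst₂; module ≡-Reasoning)
open import Relation.Binary.Structures using (IsDecTotalOrder)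
open import Relation.Nullary using (yes; no; does; contradiction)
open import Relation.Nullary.Decidable using (recompute)

-- Complete ordered fields, that is ℝ up to isomorphism.  The order is decidable,
-- as it is classically.  _⁻¹ is total; its value at 0# is unspecified.
record Reals : Set₁ where
  infix  4 _≤_
  infixl 6 _+_
  infixl 7 _*_
  infix  8 -_
  infix  9 _⁻¹
  field
    ℝ       : Set
    _+_ _*_ : ℝ → ℝ → ℝ
    -_ _⁻¹  : ℝ → ℝ
    0# 1#   : ℝ
    _≤_     : ℝ → ℝ → Set
    isCommutativeRing : IsCommutativeRing _≡_ _+_ _*_ -_ 0# 1#
    0≢1               : 0# ≢ 1#
    *-inverseʳ        : ∀ x → x ≢ 0# → x * x ⁻¹ ≡ 1#
    isDecTotalOrder   : IsDecTotalOrder _≡_ _≤_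
    +-monoʳ-≤         : ∀ z {x y} → x ≤ y → z + x ≤ z + y
    *-nonNeg          : ∀ {x y} → 0# ≤ x → 0# ≤ y → 0# ≤ x * y
    complete          : (P : ℝ → Set) → ∃ P →
                        (∃[ u ] ∀ x → P x → x ≤ u) →
                        ∃[ s ] (∀ x → P x → x ≤ s) ×
                               (∀ u → (∀ x → P x → x ≤ u) → s ≤ u)

  infixl 6 _-_
  infixl 7 _/_

  _-_ : ℝ → ℝ → ℝ
  x - y = x + - y

  _/_ : ℝ → ℝ → ℝ
  x / y = x * y ⁻¹

  commutativeRing : CommutativeRing 0ℓ 0ℓ
  commutativeRing = record { isCommutativeRing = isCommutativeRing }

module RealProperties (ℜ : Reals) where
  open Reals ℜ
  open IsDecTotalOrder isDecTotalOrder public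
    using (antisym; total; _≤?_; _≟_) renaming (refl to ≤-refl; trans to ≤-trans)
  open CommutativeRing commutativeRing public
    using (+-identityˡ; +-identityʳ; +-comm; +-assoc; -‿inverseˡ; -‿inverseʳ;
           *-identityˡ; *-identityʳ; *-comm; *-assoc; distribˡ; distribʳ; zeroˡ; zeroʳ)
  open import Algebra.Properties.Ring (CommutativeRing.ring commutativeRing) public
    using (-‿distribˡ-*; -‿distribʳ-*; [y-z]x≈yx-zx; -‿involutive)
  open ≡-Reasoning

  x+[y-x]≡y : ∀ x y → x + (y - x) ≡ y
  x+[y-x]≡y x y = begin
    x + (y - x)  ≡⟨ cong (x +_) (+-comm y (- x)) ⟩
    x + (- x + y) ≡⟨ +-assoc x (- x) y ⟨
    (x - x) + y  ≡⟨ cong (_+ y) (-‿inverseʳ x) ⟩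
    0# + y       ≡⟨ +-identityˡ y ⟩
    y            ∎

  [x+y]-x≡y : ∀ x y → (x + y) - x ≡ y
  [x+y]-x≡y x y = begin
    (x + y) - x  ≡⟨ +-assoc x y (- x) ⟩
    x + (y - x)  ≡⟨ x+[y-x]≡y x y ⟩
    y            ∎

  y-x≥0 : ∀ {x y} → x ≤ y → 0# ≤ y - x
  y-x≥0 {x} {y} x≤y =
    subst₂ _≤_ (-‿inverseˡ x) (+-comm (- x) y) (+-monoʳ-≤ (- x) x≤y)

  x≤y : ∀ {x y} → 0# ≤ y - x → x ≤ y
  x≤y {x} {y} 0≤y-x =
    subst₂ _≤_ (+-identityʳ x) (x+[y-x]≡y x y) (+-monoʳ-≤ x 0≤y-x)

  neg≥0 : ∀ {x} → x ≤ 0# → 0# ≤ - x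
  neg≥0 {x} x≤0 = subst (0# ≤_) (+-identityˡ (- x)) (y-x≥0 x≤0)

  +-nonNeg : ∀ {x y} → 0# ≤ x → 0# ≤ y → 0# ≤ x + y
  +-nonNeg {x} {y} 0≤x 0≤y =
    ≤-trans 0≤x (subst (_≤ x + y) (+-identityʳ x) (+-monoʳ-≤ x 0≤y))

  0≤1 : 0# ≤ 1#
  0≤1 with total 0# 1#
  ... | inj₁ 0≤1# = 0≤1#
  ... | inj₂ 1≤0  = subst (0# ≤_) [-1][-1]≡1 (*-nonNeg (neg≥0 1≤0) (neg≥0 1≤0))
    where
    [-1][-1]≡1 : - 1# * - 1# ≡ 1#
    [-1][-1]≡1 = begin
      - 1# * - 1#    ≡⟨ -‿distribˡ-* 1# (- 1#) ⟨
      - (1# * - 1#)  ≡⟨ cong -_ (*-identityˡ (- 1#)) ⟩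
      - - 1#         ≡⟨ -‿involutive 1# ⟩
      1#             ∎

  ⁻¹-nonNeg : ∀ {x} → 0# ≤ x → x ≢ 0# → 0# ≤ x ⁻¹
  ⁻¹-nonNeg {x} 0≤x x≢0 with total 0# (x ⁻¹)
  ... | inj₁ 0≤x⁻¹ = 0≤x⁻¹
  ... | inj₂ x⁻¹≤0 = contradiction (antisym 0≤1 1≤0) 0≢1
    where
    0≤-1 : 0# ≤ 0# - 1#
    0≤-1 = subst (0# ≤_)
      (begin
        x * - x ⁻¹    ≡⟨ -‿distribʳ-* x (x ⁻¹) ⟨
        - (x * x ⁻¹)  ≡⟨ cong -_ (*-inverseʳ x x≢0) ⟩
        - 1#          ≡⟨ +-identityˡ (- 1#) ⟨
        0# - 1#       ∎)
      (*-nonNeg 0≤x (neg≥0 x⁻¹≤0))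
    1≤0 : 1# ≤ 0#
    1≤0 = x≤y 0≤-1

  1-x≤1 : ∀ {x} → 0# ≤ x → 1# - x ≤ 1#
  1-x≤1 {x} 0≤x = x≤y (subst (0# ≤_) (sym 1-[1-x]≡x) 0≤x)
    where
    1-[1-x]≡x : 1# - (1# - x) ≡ x
    1-[1-x]≡x = begin
      1# - (1# - x)              ≡⟨ cong (_- (1# - x)) (x+[y-x]≡y x 1#) ⟨
      (x + (1# - x)) - (1# - x)  ≡⟨ cong (_- (1# - x)) (+-comm x (1# - x)) ⟩
      ((1# - x) + x) - (1# - x)  ≡⟨ [x+y]-x≡y (1# - x) x ⟩
      x                          ∎

  xy≤1 : ∀ {x y} → x ≤ 1# → 0# ≤ y → y ≤ 1# → x * y ≤ 1#
  xy≤1 {x} {y} x≤1 0≤y y≤1 = ≤-trans (x≤y (subst (0# ≤_)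
    (trans ([y-z]x≈yx-zx y 1# x) (cong (_- x * y) (*-identityˡ y)))
    (*-nonNeg (y-x≥0 x≤1) 0≤y))) y≤1

  a/[a+b]-bounds : ∀ {a b} → 0# ≤ a → 0# ≤ b → 0# ≤ a / (a + b) × a / (a + b) ≤ 1#
  a/[a+b]-bounds {a} {b} 0≤a 0≤b with (a + b) ≟ 0#
  ... | yes a+b≡0 = subst (0# ≤_) (sym ≡0) ≤-refl , subst (_≤ 1#) (sym ≡0) 0≤1
    where
    a≤a+b : a ≤ a + b
    a≤a+b = subst (_≤ a + b) (+-identityʳ a) (+-monoʳ-≤ a 0≤b)
    ≡0 : a / (a + b) ≡ 0#
    ≡0 = trans (cong (_/ (a + b)) (antisym (subst (a ≤_) a+b≡0 a≤a+b) 0≤a)) (zeroˡ _)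
  ... | no  a+b≢0 = *-nonNeg 0≤a inv≥0 , x≤y (subst (0# ≤_) b/[a+b]≡ (*-nonNeg 0≤b inv≥0))
    where
    inv≥0 : 0# ≤ (a + b) ⁻¹
    inv≥0 = ⁻¹-nonNeg (+-nonNeg 0≤a 0≤b) a+b≢0
    b/[a+b]≡ : b / (a + b) ≡ 1# - a / (a + b)
    b/[a+b]≡ = begin
      b / (a + b)                        ≡⟨ cong (_/ (a + b)) ([x+y]-x≡y a b) ⟨
      ((a + b) - a) / (a + b)            ≡⟨ [y-z]x≈yx-zx ((a + b) ⁻¹) (a + b) a ⟩
      (a + b) / (a + b) - a / (a + b)    ≡⟨ cong (_- a / (a + b)) (*-inverseʳ (a + b) a+b≢0) ⟩
      1# - a / (a + b)                   ∎

module Convexity (ℜ : Reals) where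
  open Reals ℜ
  open RealProperties ℜ

  record 𝕀 : Set where
    constructor mk𝕀
    field
      val  : ℝ
      .0≤p : 0# ≤ val
      .p≤1 : val ≤ 1#

  open 𝕀 public using (val)

  0≤val : ∀ p → 0# ≤ val p
  0≤val (mk𝕀 p 0≤p _) = recompute (0# ≤? p) 0≤p

  val≤1 : ∀ p → val p ≤ 1#
  val≤1 (mk𝕀 p _ p≤1) = recompute (p ≤? 1#) p≤1

  1ᴵ : 𝕀
  1ᴵ = mk𝕀 1# 0≤1 ≤-refl

  1-_ : 𝕀 → 𝕀
  1- p = mk𝕀 (1# - val p) (y-x≥0 (val≤1 p)) (1-x≤1 (0≤val p))

  infixl 7 _*ᴵ_
  _*ᴵ_ : 𝕀 → 𝕀 → 𝕀
  p *ᴵ q = mk𝕀 (val p * val q) (*-nonNeg (0≤val p) (0≤val q))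
               (xy≤1 (val≤1 p) (0≤val q) (val≤1 q))

  -- For p in [0,1], p < 1 and 0 < p amount to p ≠ 1 and p ≠ 0.
  _<1 : 𝕀 → Set
  p <1 = val p ≢ 1#

  0<_ : 𝕀 → Set
  0< p = val p ≢ 0#

  record IsBarycentric {A : Set} (_+⟨_⟩_ : A → 𝕀 → A → A) : Set where
    field
      +-one  : ∀ x y → x +⟨ 1ᴵ ⟩ y ≡ x
      +-idem : ∀ x p → x +⟨ p ⟩ x ≡ x
      +-skew : ∀ x y p → x +⟨ p ⟩ y ≡ y +⟨ 1- p ⟩ x
      +-skew-assoc : ∀ x y z p q r → p <1 → q <1 →
        val r ≡ ((1# - val p) * val q) / (1# - val p * val q) →
        (x +⟨ p ⟩ y) +⟨ q ⟩ z ≡ x +⟨ p *ᴵ q ⟩ (y +⟨ r ⟩ z)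

  mass : {A : Set} → List (𝕀 × A) → ℝ
  mass []             = 0#
  mass ((p , _) ∷ xs) = val p + mass xs

  mass⁺ : {A : Set} → List⁺ (𝕀 × A) → ℝ
  mass⁺ = mass ∘ List⁺.toList

  mass-nonNeg : {A : Set} (xs : List (𝕀 × A)) → 0# ≤ mass xs
  mass-nonNeg []             = ≤-refl
  mass-nonNeg ((p , _) ∷ xs) = +-nonNeg (0≤val p) (mass-nonNeg xs)

  -- The share p / (p + m) of the first of several weights, m being the sum of
  -- the others.  If p + m is 0, so is the share.
  share : {A : Set} → 𝕀 → List (𝕀 × A) → 𝕀
  share p xs = mk𝕀 (val p / (val p + mass xs)) (proj₁ bounds) (proj₂ bounds)
    where
    bounds : 0# ≤ val p / (val p + mass xs) × val p / (val p + mass xs) ≤ 1#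
    bounds = a/[a+b]-bounds (0≤val p) (mass-nonNeg xs)

  -- The combination p₁x₁ + … + pₙxₙ is x₁ combined, with its share of the total
  -- weight, with the combination of the remaining points, whose weights need not
  -- sum to 1: the division in share renormalises them.
  module _ {A : Set} (_+⟨_⟩_ : A → 𝕀 → A → A) where
    combineFrom : 𝕀 × A → List (𝕀 × A) → A
    combineFrom (_ , x) []       = x
    combineFrom (p , x) (y ∷ ys) = x +⟨ share p (y ∷ ys) ⟩ combineFrom y ys

    combine : List⁺ (𝕀 × A) → A
    combine (x ∷ xs) = combineFrom x xs

  -- A finitely supported distribution is given by a formal convex combination
  -- p₁x₁ + … + pₙxₙ.  Points may repeat and weights may vanish; presentations of
  -- the same distribution are not identified.
  record Dist (A : Set) : Set where
    constructor mkDist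
    field
      points  : List⁺ (𝕀 × A)
      .mass≡1 : mass⁺ points ≡ 1#

  open Dist public using (points)

  ∑ : {A B : Set} → (B → 𝕀 → B → B) → Dist A → (A → B) → B
  ∑ _+⟨_⟩_ μ f = combine _+⟨_⟩_ (List⁺.map (λ (p , x) → p , f x) (points μ))

  dirac : {A : Set} → A → Dist A
  dirac x = mkDist ((1ᴵ , x) ∷ []) (+-identityʳ 1#)

  mass-map : {A B : Set} (f : A → B) (xs : List (𝕀 × A)) →
             mass (map (λ (p , x) → p , f x) xs) ≡ mass xs
  mass-map f []             = refl
  mass-map f ((p , _) ∷ xs) = cong (val p +_) (mass-map f xs)

  mapᴰ : {A B : Set} → (A → B) → Dist A → Dist B
  mapᴰ f (mkDist xs m≡1) =
    mkDist (List⁺.map (λ (p , x) → p , f x) xs)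
           (trans (mass-map f (List⁺.toList xs)) m≡1)

  scale : {A : Set} → 𝕀 → List⁺ (𝕀 × A) → List⁺ (𝕀 × A)
  scale p = List⁺.map (λ (q , x) → p *ᴵ q , x)

  mass-++ : {A : Set} (us vs : List (𝕀 × A)) → mass (us ++ vs) ≡ mass us + mass vs
  mass-++ []             vs = sym (+-identityˡ _)
  mass-++ ((q , _) ∷ us) vs =
    trans (cong (val q +_) (mass-++ us vs)) (sym (+-assoc _ _ _))

  mass-scale : {A : Set} (q : 𝕀) (us : List (𝕀 × A)) →
               mass (map (λ (r , x) → q *ᴵ r , x) us) ≡ val q * mass us
  mass-scale q []             = sym (zeroʳ _)
  mass-scale q ((r , _) ∷ us) =
    trans (cong (val q * val r +_) (mass-scale q us)) (sym (distribˡ _ _ _))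

  mass-mix : {A : Set} (xs : List⁺ (𝕀 × A)) (p : 𝕀) (ys : List⁺ (𝕀 × A)) →
             mass⁺ xs ≡ 1# → mass⁺ ys ≡ 1# →
             mass⁺ (scale p xs ⁺++⁺ scale (1- p) ys) ≡ 1#
  mass-mix xs p ys m≡1 n≡1 = begin
    mass⁺ (scale p xs ⁺++⁺ scale (1- p) ys)
      ≡⟨ mass-++ (List⁺.toList (scale p xs)) (List⁺.toList (scale (1- p) ys)) ⟩
    mass⁺ (scale p xs) + mass⁺ (scale (1- p) ys)
      ≡⟨ cong₂ _+_ (mass-scale p (List⁺.toList xs)) (mass-scale (1- p) (List⁺.toList ys)) ⟩
    val p * mass⁺ xs + (1# - val p) * mass⁺ ys
      ≡⟨ cong₂ _+_ (cong (val p *_) m≡1) (cong ((1# - val p) *_) n≡1) ⟩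
    val p * 1# + (1# - val p) * 1#
      ≡⟨ cong₂ _+_ (*-identityʳ _) (*-identityʳ _) ⟩
    val p + (1# - val p)
      ≡⟨ x+[y-x]≡y (val p) 1# ⟩
    1# ∎
    where open ≡-Reasoning

  mix : {A : Set} → Dist A → 𝕀 → Dist A → Dist A
  mix (mkDist xs m≡1) p (mkDist ys n≡1) =
    mkDist (scale p xs ⁺++⁺ scale (1- p) ys) (mass-mix xs p ys m≡1 n≡1)

record Rewards (ℜ : Reals) : Set₁ where
  open Convexity ℜ
  infix  4 _≤ᴿ_
  infixl 6 _+ᴿ_
  field
    R                   : Set
    _+⟨_⟩ᴿ_             : R → 𝕀 → R → R
    _+ᴿ_                : R → R → R
    0ᴿ                  : R
    _≤ᴿ_                : R → R → Set
    isBarycentric       : IsBarycentric _+⟨_⟩ᴿ_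
    isCommutativeMonoid : IsCommutativeMonoid _≡_ _+ᴿ_ 0ᴿ
    +ᴿ-distribˡ         : ∀ r s p s′ → r +ᴿ (s +⟨ p ⟩ᴿ s′) ≡ (r +ᴿ s) +⟨ p ⟩ᴿ (r +ᴿ s′)
    isDecTotalOrder     : IsDecTotalOrder _≡_ _≤ᴿ_
    ≤ᴿ-+                : ∀ r s t → r ≤ᴿ s ⇔ r +ᴿ t ≤ᴿ s +ᴿ t
    ≤ᴿ-+⟨⟩              : ∀ r s t p → 0< p → p <1 →
                          r ≤ᴿ s ⇔ (r +⟨ p ⟩ᴿ t) ≤ᴿ (s +⟨ p ⟩ᴿ t)

  open IsDecTotalOrder isDecTotalOrder public using ()
    renaming (refl to ≤ᴿ-refl; trans to ≤ᴿ-trans; antisym to ≤ᴿ-antisym;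
              total to ≤ᴿ-total; _≤?_ to _≤ᴿ?_)

record IsBarycentricModule {ℜ : Reals} (ℛ : Rewards ℜ) {A : Set}
         (_·_ : Rewards.R ℛ → A → A)
         (_+⟨_⟩_ : A → Convexity.𝕀 ℜ → A → A) : Set where
  open Rewards ℛ using (0ᴿ; _+ᴿ_)
  field
    isBarycentric : Convexity.IsBarycentric ℜ _+⟨_⟩_
    ·-identity    : ∀ x → 0ᴿ · x ≡ x
    ·-action      : ∀ r s x → r · (s · x) ≡ (r +ᴿ s) · x
    ·-distrib     : ∀ r x p y → r · (x +⟨ p ⟩ y) ≡ (r · x) +⟨ p ⟩ (r · y)

-- rew and bool are constructors so that their interpretations compute to R and Bool.
data Base (B : Set) : Set where
  bool rew : Base B
  other    : B → Base B

record Signature (ℜ : Reals) : Set₁ where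
  open Convexity ℜ using (𝕀)
  field
    OtherBase : Set
  Bas : Set
  Bas = Base OtherBase
  field
    Const   : Bas → Set
    tt′ ff′ : Const bool
    0′      : Const rew
    Fun     : List Bas → Bas → Set
    eq′     : ∀ b → Fun (b ∷ b ∷ []) bool
    plus′   : Fun (rew ∷ rew ∷ []) rew
    oplus′  : 𝕀 → Fun (rew ∷ rew ∷ []) rew
    leq′    : Fun (rew ∷ rew ∷ []) bool
    valᶠ    : ∀ {bs b} → Fun bs b → All Const bs → Const b
    val-eq-same : ∀ {b} (c : Const b) → valᶠ (eq′ b) (c ∷ c ∷ []) ≡ tt′
    val-eq-diff : ∀ {b} (c c′ : Const b) → c ≢ c′ → valᶠ (eq′ b) (c ∷ c′ ∷ []) ≡ ff′

module Language {ℜ : Reals} (Sg : Signature ℜ) where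
  open Convexity ℜ using (𝕀)
  open Signature Sg

  infixr 6 _⇒_
  infixr 7 _`×_

  data Type : Set where
    base : Bas → Type
    unit : Type
    _`×_ : Type → Type → Type
    _⇒_  : Type → Type → Type

  Ctx : Set
  Ctx = List Type

  data Term (Γ : Ctx) : Type → Set where
    var    : ∀ {σ} → σ ∈ Γ → Term Γ σ
    con    : ∀ {b} → Const b → Term Γ (base b)
    fun    : ∀ {bs b} → Fun bs b → All (λ b′ → Term Γ (base b′)) bs → Term Γ (base b)
    cond   : ∀ {σ} → Term Γ (base bool) → Term Γ σ → Term Γ σ → Term Γ σ
    _or_   : ∀ {σ} → Term Γ σ → Term Γ σ → Term Γ σ
    _·_    : ∀ {σ} → Term Γ (base rew) → Term Γ σ → Term Γ σ
    _+⟨_⟩_ : ∀ {σ} → Term Γ σ → 𝕀 → Term Γ σ → Term Γ σ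
    ⋆      : Term Γ unit
    ⟨_,_⟩  : ∀ {σ τ} → Term Γ σ → Term Γ τ → Term Γ (σ `× τ)
    fst    : ∀ {σ τ} → Term Γ (σ `× τ) → Term Γ σ
    snd    : ∀ {σ τ} → Term Γ (σ `× τ) → Term Γ τ
    lam    : ∀ {σ τ} → Term (σ ∷ Γ) τ → Term Γ (σ ⇒ τ)
    app    : ∀ {σ τ} → Term Γ (σ ⇒ τ) → Term Γ σ → Term Γ τ

  Args : Ctx → List Bas → Set
  Args Γ bs = All (λ b → Term Γ (base b)) bs

  Program : Type → Set
  Program σ = Term [] σ

  Ren Sub : Ctx → Ctx → Set
  Ren Γ Δ = ∀ {σ} → σ ∈ Γ → σ ∈ Δ
  Sub Γ Δ = ∀ {σ} → σ ∈ Γ → Term Δ σ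

  extᴿ : ∀ {Γ Δ σ} → Ren Γ Δ → Ren (σ ∷ Γ) (σ ∷ Δ)
  extᴿ ρ (here e)  = here e
  extᴿ ρ (there x) = there (ρ x)

  mutual
    ren : ∀ {Γ Δ} → Ren Γ Δ → ∀ {σ} → Term Γ σ → Term Δ σ
    ren ρ (var x)         = var (ρ x)
    ren ρ (con c)         = con c
    ren ρ (fun f Ms)      = fun f (renArgs ρ Ms)
    ren ρ (cond L M N)    = cond (ren ρ L) (ren ρ M) (ren ρ N)
    ren ρ (M or N)        = ren ρ M or ren ρ N
    ren ρ (N · M)         = ren ρ N · ren ρ M
    ren ρ (M +⟨ p ⟩ N)    = ren ρ M +⟨ p ⟩ ren ρ N
    ren ρ ⋆               = ⋆
    ren ρ ⟨ M , N ⟩       = ⟨ ren ρ M , ren ρ N ⟩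
    ren ρ (fst M)         = fst (ren ρ M)
    ren ρ (snd M)         = snd (ren ρ M)
    ren ρ (lam M)         = lam (ren (extᴿ ρ) M)
    ren ρ (app M N)       = app (ren ρ M) (ren ρ N)

    renArgs : ∀ {Γ Δ} → Ren Γ Δ → ∀ {bs} → Args Γ bs → Args Δ bs
    renArgs ρ []       = []
    renArgs ρ (M ∷ Ms) = ren ρ M ∷ renArgs ρ Ms

  extˢ : ∀ {Γ Δ σ} → Sub Γ Δ → Sub (σ ∷ Γ) (σ ∷ Δ)
  extˢ θ (here e)  = var (here e)
  extˢ θ (there x) = ren there (θ x)

  mutual
    sub : ∀ {Γ Δ} → Sub Γ Δ → ∀ {σ} → Term Γ σ → Term Δ σ
    sub θ (var x)         = θ x
    sub θ (con c)         = con c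
    sub θ (fun f Ms)      = fun f (subArgs θ Ms)
    sub θ (cond L M N)    = cond (sub θ L) (sub θ M) (sub θ N)
    sub θ (M or N)        = sub θ M or sub θ N
    sub θ (N · M)         = sub θ N · sub θ M
    sub θ (M +⟨ p ⟩ N)    = sub θ M +⟨ p ⟩ sub θ N
    sub θ ⋆               = ⋆
    sub θ ⟨ M , N ⟩       = ⟨ sub θ M , sub θ N ⟩
    sub θ (fst M)         = fst (sub θ M)
    sub θ (snd M)         = snd (sub θ M)
    sub θ (lam M)         = lam (sub (extˢ θ) M)
    sub θ (app M N)       = app (sub θ M) (sub θ N)

    subArgs : ∀ {Γ Δ} → Sub Γ Δ → ∀ {bs} → Args Γ bs → Args Δ bs
    subArgs θ []       = []
    subArgs θ (M ∷ Ms) = sub θ M ∷ subArgs θ Ms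

  _,ˢ_ : ∀ {Γ Δ σ} → Sub Γ Δ → Term Δ σ → Sub (σ ∷ Γ) Δ
  (θ ,ˢ N) (here refl) = N
  (θ ,ˢ N) (there x)   = θ x

  _[_] : ∀ {Γ σ τ} → Term (σ ∷ Γ) τ → Term Γ σ → Term Γ τ
  M [ N ] = sub (var ,ˢ N) M

  data Val : Type → Set where
    con   : ∀ {b} → Const b → Val (base b)
    ⋆     : Val unit
    ⟨_,_⟩ : ∀ {σ τ} → Val σ → Val τ → Val (σ `× τ)
    lam   : ∀ {σ τ} → Term (σ ∷ []) τ → Val (σ ⇒ τ)

  ⌜_⌝ : ∀ {σ} → Val σ → Program σ
  ⌜ con c ⌝     = con c
  ⌜ ⋆ ⌝         = ⋆
  ⌜ ⟨ V , W ⟩ ⌝ = ⟨ ⌜ V ⌝ , ⌜ W ⌝ ⟩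
  ⌜ lam M ⌝     = lam M

  data EffVal (σ : Type) : Set where
    val    : Val σ → EffVal σ
    _or_   : EffVal σ → EffVal σ → EffVal σ
    _·_    : Const rew → EffVal σ → EffVal σ
    _+⟨_⟩_ : EffVal σ → 𝕀 → EffVal σ → EffVal σ

  -- Argument lists c₁, …, cₖ₋₁, [ ], Mₖ₊₁, …, Mₘ; the index b is the type of the hole.
  data ArgsCxt : List Bas → Bas → Set where
    hole : ∀ {b bs} → Args [] bs → ArgsCxt (b ∷ bs) b
    _∷_  : ∀ {b b′ bs} → Const b′ → ArgsCxt bs b → ArgsCxt (b′ ∷ bs) b

  fillArgs : ∀ {bs b} → ArgsCxt bs b → Program (base b) → Args [] bs
  fillArgs (hole Ms) M = M ∷ Ms
  fillArgs (c ∷ A)   M = con c ∷ fillArgs A M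

  -- EvCxt σ τ: the hole has type σ, the whole type τ.
  data EvCxt (σ : Type) : Type → Set where
    □     : EvCxt σ σ
    fun   : ∀ {bs b b′} → Fun bs b → ArgsCxt bs b′ → EvCxt σ (base b′) → EvCxt σ (base b)
    cond  : ∀ {τ} → EvCxt σ (base bool) → Program τ → Program τ → EvCxt σ τ
    _·_   : ∀ {τ} → EvCxt σ (base rew) → Program τ → EvCxt σ τ
    ⟨_,_⟩ˡ : ∀ {τ υ} → EvCxt σ τ → Program υ → EvCxt σ (τ `× υ)
    ⟨_,_⟩ʳ : ∀ {τ υ} → Val τ → EvCxt σ υ → EvCxt σ (τ `× υ)
    fst   : ∀ {τ υ} → EvCxt σ (τ `× υ) → EvCxt σ τ
    snd   : ∀ {τ υ} → EvCxt σ (τ `× υ) → EvCxt σ υ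
    appˡ  : ∀ {τ υ} → EvCxt σ (τ ⇒ υ) → Program τ → EvCxt σ υ
    appʳ  : ∀ {τ υ} → Term (τ ∷ []) υ → EvCxt σ τ → EvCxt σ υ

  _⟦_⟧ : ∀ {σ τ} → EvCxt σ τ → Program σ → Program τ
  □            ⟦ Q ⟧ = Q
  fun f A 𝓔    ⟦ Q ⟧ = fun f (fillArgs A (𝓔 ⟦ Q ⟧))
  cond 𝓔 M N   ⟦ Q ⟧ = cond (𝓔 ⟦ Q ⟧) M N
  (𝓔 · M)      ⟦ Q ⟧ = (𝓔 ⟦ Q ⟧) · M
  ⟨ 𝓔 , N ⟩ˡ   ⟦ Q ⟧ = ⟨ 𝓔 ⟦ Q ⟧ , N ⟩
  ⟨ V , 𝓔 ⟩ʳ   ⟦ Q ⟧ = ⟨ ⌜ V ⌝ , 𝓔 ⟦ Q ⟧ ⟩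
  fst 𝓔        ⟦ Q ⟧ = fst (𝓔 ⟦ Q ⟧)
  snd 𝓔        ⟦ Q ⟧ = snd (𝓔 ⟦ Q ⟧)
  appˡ 𝓔 N     ⟦ Q ⟧ = app (𝓔 ⟦ Q ⟧) N
  appʳ M 𝓔     ⟦ Q ⟧ = app (lam M) (𝓔 ⟦ Q ⟧)

  infix 3 _⟶ᵣ_ _⟶_ _⇓_

  data _⟶ᵣ_ : ∀ {σ} → Program σ → Program σ → Set where
    δ-fun   : ∀ {bs b} (f : Fun bs b) (cs : All Const bs) →
              fun f (All.map con cs) ⟶ᵣ con (valᶠ f cs)
    if-tt   : ∀ {σ} {M N : Program σ} → cond (con tt′) M N ⟶ᵣ M
    if-ff   : ∀ {σ} {M N : Program σ} → cond (con ff′) M N ⟶ᵣ N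
    fst-β   : ∀ {σ τ} (V : Val σ) (W : Val τ) → fst ⟨ ⌜ V ⌝ , ⌜ W ⌝ ⟩ ⟶ᵣ ⌜ V ⌝
    snd-β   : ∀ {σ τ} (V : Val σ) (W : Val τ) → snd ⟨ ⌜ V ⌝ , ⌜ W ⌝ ⟩ ⟶ᵣ ⌜ W ⌝
    app-β   : ∀ {σ τ} (M : Term (σ ∷ []) τ) (V : Val σ) → app (lam M) ⌜ V ⌝ ⟶ᵣ M [ ⌜ V ⌝ ]

  data _⟶_ {τ} : Program τ → Program τ → Set where
    cxt : ∀ {σ} (𝓔 : EvCxt σ τ) {Q Q′ : Program σ} → Q ⟶ᵣ Q′ → 𝓔 ⟦ Q ⟧ ⟶ 𝓔 ⟦ Q′ ⟧

  -- M ⇓ E reads Op(M) = E: the rules are the defining equations of Op.  Op itself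
  -- is obtained from the totality of ⇓, proved in Normalisation.
  data _⇓_ {τ} : Program τ → EffVal τ → Set where
    ⇓-val  : ∀ V → ⌜ V ⌝ ⇓ val V
    ⇓-step : ∀ {M M′ E} → M ⟶ M′ → M′ ⇓ E → M ⇓ E
    ⇓-or   : ∀ {σ} (𝓔 : EvCxt σ τ) {M₁ M₂ E₁ E₂} →
             𝓔 ⟦ M₁ ⟧ ⇓ E₁ → 𝓔 ⟦ M₂ ⟧ ⇓ E₂ → 𝓔 ⟦ M₁ or M₂ ⟧ ⇓ E₁ or E₂
    ⇓-+    : ∀ {σ} (𝓔 : EvCxt σ τ) {M₁ M₂ p E₁ E₂} →
             𝓔 ⟦ M₁ ⟧ ⇓ E₁ → 𝓔 ⟦ M₂ ⟧ ⇓ E₂ → 𝓔 ⟦ M₁ +⟨ p ⟩ M₂ ⟧ ⇓ E₁ +⟨ p ⟩ E₂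
    ⇓-·    : ∀ {σ} (𝓔 : EvCxt σ τ) {c M₁ E} →
             𝓔 ⟦ M₁ ⟧ ⇓ E → 𝓔 ⟦ con c · M₁ ⟧ ⇓ c · E

⟦_⟧ᴮ : {B : Set} → Base B → (R : Set) → (B → Set) → Set
⟦ bool ⟧ᴮ    R ⟦other⟧ = Bool
⟦ rew ⟧ᴮ     R ⟦other⟧ = R
⟦ other b ⟧ᴮ R ⟦other⟧ = ⟦other⟧ b

record Interpretation {ℜ : Reals} (Sg : Signature ℜ) (ℛ : Rewards ℜ) : Set₁ where
  open Signature Sg
  open Rewards ℛ
  field
    ⟦other⟧ : OtherBase → Set
  ⟦_⟧ᵇ : Bas → Set
  ⟦ b ⟧ᵇ = ⟦ b ⟧ᴮ R ⟦other⟧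
  field
    nonempty    : ∀ b → ⟦other⟧ b
    ⟦_⟧ᶜ        : ∀ {b} → Const b → ⟦ b ⟧ᵇ
    ⟦tt⟧        : ⟦ tt′ ⟧ᶜ ≡ true
    ⟦ff⟧        : ⟦ ff′ ⟧ᶜ ≡ false
    ⟦0⟧         : ⟦ 0′ ⟧ᶜ ≡ 0ᴿ
    ⟦⟧ᶜ-injective : ∀ {b} {c c′ : Const b} → ⟦ c ⟧ᶜ ≡ ⟦ c′ ⟧ᶜ → c ≡ c′
    ⟦⟧ᶜ-nonzero : ∃[ c ] ⟦_⟧ᶜ {rew} c ≢ 0ᴿ
    ⟦_⟧ᶠ        : ∀ {bs b} → Fun bs b → All ⟦_⟧ᵇ bs → ⟦ b ⟧ᵇ
    ⟦plus⟧      : ∀ r s → ⟦ plus′ ⟧ᶠ (r ∷ s ∷ []) ≡ r +ᴿ s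
    ⟦oplus⟧     : ∀ p r s → ⟦ oplus′ p ⟧ᶠ (r ∷ s ∷ []) ≡ r +⟨ p ⟩ᴿ s
    ⟦leq⟧       : ∀ r s → ⟦ leq′ ⟧ᶠ (r ∷ s ∷ []) ≡ does (r ≤ᴿ? s)
    ⟦val⟧       : ∀ {bs b} (f : Fun bs b) (cs : All Const bs) →
                  ⟦ f ⟧ᶠ (All.map ⟦_⟧ᶜ cs) ≡ ⟦ valᶠ f cs ⟧ᶜ

module Fusion {ℜ : Reals} (Sg : Signature ℜ) where
  open Language Sg

  cong₃ : {A B C D : Set} (f : A → B → C → D) → ∀ {a a′ b b′ c c′} →
          a ≡ a′ → b ≡ b′ → c ≡ c′ → f a b c ≡ f a′ b′ c′
  cong₃ f refl refl refl = refl

  mutual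
    ren-ren : ∀ {Γ Δ Θ} {ρ : Ren Γ Δ} {ρ′ : Ren Δ Θ} {ρ″ : Ren Γ Θ} →
              (∀ {σ} (x : σ ∈ Γ) → ρ′ (ρ x) ≡ ρ″ x) →
              ∀ {σ} (M : Term Γ σ) → ren ρ′ (ren ρ M) ≡ ren ρ″ M
    ren-ren h (var x)      = cong var (h x)
    ren-ren h (con c)      = refl
    ren-ren h (fun f Ms)   = cong (fun f) (ren-renArgs h Ms)
    ren-ren h (cond L M N) = cong₃ cond (ren-ren h L) (ren-ren h M) (ren-ren h N)
    ren-ren h (M or N)     = cong₂ _or_ (ren-ren h M) (ren-ren h N)
    ren-ren h (N · M)      = cong₂ _·_ (ren-ren h N) (ren-ren h M)
    ren-ren h (M +⟨ p ⟩ N) = cong₂ (_+⟨ p ⟩_) (ren-ren h M) (ren-ren h N)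
    ren-ren h ⋆            = refl
    ren-ren h ⟨ M , N ⟩    = cong₂ ⟨_,_⟩ (ren-ren h M) (ren-ren h N)
    ren-ren h (fst M)      = cong fst (ren-ren h M)
    ren-ren h (snd M)      = cong snd (ren-ren h M)
    ren-ren h (lam M)      = cong lam (ren-ren (λ where (here _) → refl
                                                        (there x) → cong there (h x)) M)
    ren-ren h (app M N)    = cong₂ app (ren-ren h M) (ren-ren h N)

    ren-renArgs : ∀ {Γ Δ Θ} {ρ : Ren Γ Δ} {ρ′ : Ren Δ Θ} {ρ″ : Ren Γ Θ} →
                  (∀ {σ} (x : σ ∈ Γ) → ρ′ (ρ x) ≡ ρ″ x) →
                  ∀ {bs} (Ms : Args Γ bs) → renArgs ρ′ (renArgs ρ Ms) ≡ renArgs ρ″ Ms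
    ren-renArgs h []       = refl
    ren-renArgs h (M ∷ Ms) = cong₂ _∷_ (ren-ren h M) (ren-renArgs h Ms)

  mutual
    sub-ren : ∀ {Γ Δ Θ} {ρ : Ren Γ Δ} {θ : Sub Δ Θ} {φ : Sub Γ Θ} →
              (∀ {σ} (x : σ ∈ Γ) → θ (ρ x) ≡ φ x) →
              ∀ {σ} (M : Term Γ σ) → sub θ (ren ρ M) ≡ sub φ M
    sub-ren h (var x)      = h x
    sub-ren h (con c)      = refl
    sub-ren h (fun f Ms)   = cong (fun f) (sub-renArgs h Ms)
    sub-ren h (cond L M N) = cong₃ cond (sub-ren h L) (sub-ren h M) (sub-ren h N)
    sub-ren h (M or N)     = cong₂ _or_ (sub-ren h M) (sub-ren h N)
    sub-ren h (N · M)      = cong₂ _·_ (sub-ren h N) (sub-ren h M)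
    sub-ren h (M +⟨ p ⟩ N) = cong₂ (_+⟨ p ⟩_) (sub-ren h M) (sub-ren h N)
    sub-ren h ⋆            = refl
    sub-ren h ⟨ M , N ⟩    = cong₂ ⟨_,_⟩ (sub-ren h M) (sub-ren h N)
    sub-ren h (fst M)      = cong fst (sub-ren h M)
    sub-ren h (snd M)      = cong snd (sub-ren h M)
    sub-ren h (lam M)      = cong lam (sub-ren (λ where (here _) → refl
                                                        (there x) → cong (ren there) (h x)) M)
    sub-ren h (app M N)    = cong₂ app (sub-ren h M) (sub-ren h N)

    sub-renArgs : ∀ {Γ Δ Θ} {ρ : Ren Γ Δ} {θ : Sub Δ Θ} {φ : Sub Γ Θ} →
                  (∀ {σ} (x : σ ∈ Γ) → θ (ρ x) ≡ φ x) →
                  ∀ {bs} (Ms : Args Γ bs) → subArgs θ (renArgs ρ Ms) ≡ subArgs φ Ms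
    sub-renArgs h []       = refl
    sub-renArgs h (M ∷ Ms) = cong₂ _∷_ (sub-ren h M) (sub-renArgs h Ms)

  ren-there : ∀ {Γ Δ σ τ} {ρ : Ren Γ Δ} (M : Term Γ τ) →
              ren (extᴿ {σ = σ} ρ) (ren there M) ≡ ren there (ren ρ M)
  ren-there M = trans (ren-ren (λ _ → refl) M) (sym (ren-ren (λ _ → refl) M))

  mutual
    ren-sub : ∀ {Γ Δ Θ} {θ : Sub Γ Δ} {ρ : Ren Δ Θ} {φ : Sub Γ Θ} →
              (∀ {σ} (x : σ ∈ Γ) → ren ρ (θ x) ≡ φ x) →
              ∀ {σ} (M : Term Γ σ) → ren ρ (sub θ M) ≡ sub φ M
    ren-sub h (var x)      = h x
    ren-sub h (con c)      = refl
    ren-sub h (fun f Ms)   = cong (fun f) (ren-subArgs h Ms)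
    ren-sub h (cond L M N) = cong₃ cond (ren-sub h L) (ren-sub h M) (ren-sub h N)
    ren-sub h (M or N)     = cong₂ _or_ (ren-sub h M) (ren-sub h N)
    ren-sub h (N · M)      = cong₂ _·_ (ren-sub h N) (ren-sub h M)
    ren-sub h (M +⟨ p ⟩ N) = cong₂ (_+⟨ p ⟩_) (ren-sub h M) (ren-sub h N)
    ren-sub h ⋆            = refl
    ren-sub h ⟨ M , N ⟩    = cong₂ ⟨_,_⟩ (ren-sub h M) (ren-sub h N)
    ren-sub h (fst M)      = cong fst (ren-sub h M)
    ren-sub h (snd M)      = cong snd (ren-sub h M)
    ren-sub {θ = θ} h (lam M) =
      cong lam (ren-sub (λ where (here _) → refl
                                 (there x) → trans (ren-there (θ x)) (cong (ren there) (h x))) M)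
    ren-sub h (app M N)    = cong₂ app (ren-sub h M) (ren-sub h N)

    ren-subArgs : ∀ {Γ Δ Θ} {θ : Sub Γ Δ} {ρ : Ren Δ Θ} {φ : Sub Γ Θ} →
                  (∀ {σ} (x : σ ∈ Γ) → ren ρ (θ x) ≡ φ x) →
                  ∀ {bs} (Ms : Args Γ bs) → renArgs ρ (subArgs θ Ms) ≡ subArgs φ Ms
    ren-subArgs h []       = refl
    ren-subArgs h (M ∷ Ms) = cong₂ _∷_ (ren-sub h M) (ren-subArgs h Ms)

  sub-there : ∀ {Γ Δ σ τ} {θ : Sub Γ Δ} (M : Term Γ τ) →
              sub (extˢ {σ = σ} θ) (ren there M) ≡ ren there (sub θ M)
  sub-there M = trans (sub-ren (λ _ → refl) M) (sym (ren-sub (λ _ → refl) M))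

  mutual
    sub-sub : ∀ {Γ Δ Θ} {θ : Sub Γ Δ} {θ′ : Sub Δ Θ} {φ : Sub Γ Θ} →
              (∀ {σ} (x : σ ∈ Γ) → sub θ′ (θ x) ≡ φ x) →
              ∀ {σ} (M : Term Γ σ) → sub θ′ (sub θ M) ≡ sub φ M
    sub-sub h (var x)      = h x
    sub-sub h (con c)      = refl
    sub-sub h (fun f Ms)   = cong (fun f) (sub-subArgs h Ms)
    sub-sub h (cond L M N) = cong₃ cond (sub-sub h L) (sub-sub h M) (sub-sub h N)
    sub-sub h (M or N)     = cong₂ _or_ (sub-sub h M) (sub-sub h N)
    sub-sub h (N · M)      = cong₂ _·_ (sub-sub h N) (sub-sub h M)
    sub-sub h (M +⟨ p ⟩ N) = cong₂ (_+⟨ p ⟩_) (sub-sub h M) (sub-sub h N)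
    sub-sub h ⋆            = refl
    sub-sub h ⟨ M , N ⟩    = cong₂ ⟨_,_⟩ (sub-sub h M) (sub-sub h N)
    sub-sub h (fst M)      = cong fst (sub-sub h M)
    sub-sub h (snd M)      = cong snd (sub-sub h M)
    sub-sub {θ = θ} h (lam M) =
      cong lam (sub-sub (λ where (here _) → refl
                                 (there x) → trans (sub-there (θ x)) (cong (ren there) (h x))) M)
    sub-sub h (app M N)    = cong₂ app (sub-sub h M) (sub-sub h N)

    sub-subArgs : ∀ {Γ Δ Θ} {θ : Sub Γ Δ} {θ′ : Sub Δ Θ} {φ : Sub Γ Θ} →
                  (∀ {σ} (x : σ ∈ Γ) → sub θ′ (θ x) ≡ φ x) →
                  ∀ {bs} (Ms : Args Γ bs) → subArgs θ′ (subArgs θ Ms) ≡ subArgs φ Ms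
    sub-subArgs h []       = refl
    sub-subArgs h (M ∷ Ms) = cong₂ _∷_ (sub-sub h M) (sub-subArgs h Ms)

  mutual
    sub-id : ∀ {Γ} {θ : Sub Γ Γ} → (∀ {σ} (x : σ ∈ Γ) → θ x ≡ var x) →
             ∀ {σ} (M : Term Γ σ) → sub θ M ≡ M
    sub-id h (var x)      = h x
    sub-id h (con c)      = refl
    sub-id h (fun f Ms)   = cong (fun f) (sub-idArgs h Ms)
    sub-id h (cond L M N) = cong₃ cond (sub-id h L) (sub-id h M) (sub-id h N)
    sub-id h (M or N)     = cong₂ _or_ (sub-id h M) (sub-id h N)
    sub-id h (N · M)      = cong₂ _·_ (sub-id h N) (sub-id h M)
    sub-id h (M +⟨ p ⟩ N) = cong₂ (_+⟨ p ⟩_) (sub-id h M) (sub-id h N)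
    sub-id h ⋆            = refl
    sub-id h ⟨ M , N ⟩    = cong₂ ⟨_,_⟩ (sub-id h M) (sub-id h N)
    sub-id h (fst M)      = cong fst (sub-id h M)
    sub-id h (snd M)      = cong snd (sub-id h M)
    sub-id h (lam M)      = cong lam (sub-id (λ where (here refl) → refl
                                                      (there x) → cong (ren there) (h x)) M)
    sub-id h (app M N)    = cong₂ app (sub-id h M) (sub-id h N)

    sub-idArgs : ∀ {Γ} {θ : Sub Γ Γ} → (∀ {σ} (x : σ ∈ Γ) → θ x ≡ var x) →
                 ∀ {bs} (Ms : Args Γ bs) → subArgs θ Ms ≡ Ms
    sub-idArgs h []       = refl
    sub-idArgs h (M ∷ Ms) = cong₂ _∷_ (sub-id h M) (sub-idArgs h Ms)

  ext-[] : ∀ {Γ Δ σ τ} (θ : Sub Γ Δ) (M : Term (σ ∷ Γ) τ) (N : Term Δ σ) →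
           sub (extˢ θ) M [ N ] ≡ sub (θ ,ˢ N) M
  ext-[] θ M N = sub-sub
    (λ where (here refl) → refl
             (there x)   → trans (sub-ren (λ _ → refl) (θ x)) (sub-id (λ _ → refl) (θ x))) M

module Normalisation {ℜ : Reals} {Sg : Signature ℜ} {ℛ : Rewards ℜ}
                     (I : Interpretation Sg ℛ) where
  open Signature Sg
  open Interpretation I
  open Language Sg
  open Fusion Sg

  bool-canonical : (c : Const bool) → c ≡ tt′ ⊎ c ≡ ff′
  bool-canonical c with ⟦ c ⟧ᶜ in eq
  ... | true  = inj₁ (⟦⟧ᶜ-injective (trans eq (sym ⟦tt⟧)))
  ... | false = inj₂ (⟦⟧ᶜ-injective (trans eq (sym ⟦ff⟧)))

  infixr 9 _∘ᴱ_
  _∘ᴱ_ : ∀ {σ τ υ} → EvCxt τ υ → EvCxt σ τ → EvCxt σ υ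
  □          ∘ᴱ 𝓕 = 𝓕
  fun f A 𝓔  ∘ᴱ 𝓕 = fun f A (𝓔 ∘ᴱ 𝓕)
  cond 𝓔 M N ∘ᴱ 𝓕 = cond (𝓔 ∘ᴱ 𝓕) M N
  (𝓔 · M)    ∘ᴱ 𝓕 = (𝓔 ∘ᴱ 𝓕) · M
  ⟨ 𝓔 , N ⟩ˡ ∘ᴱ 𝓕 = ⟨ 𝓔 ∘ᴱ 𝓕 , N ⟩ˡ
  ⟨ V , 𝓔 ⟩ʳ ∘ᴱ 𝓕 = ⟨ V , 𝓔 ∘ᴱ 𝓕 ⟩ʳ
  fst 𝓔      ∘ᴱ 𝓕 = fst (𝓔 ∘ᴱ 𝓕)
  snd 𝓔      ∘ᴱ 𝓕 = snd (𝓔 ∘ᴱ 𝓕)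
  appˡ 𝓔 N   ∘ᴱ 𝓕 = appˡ (𝓔 ∘ᴱ 𝓕) N
  appʳ M 𝓔   ∘ᴱ 𝓕 = appʳ M (𝓔 ∘ᴱ 𝓕)

  ∘ᴱ-⟦⟧ : ∀ {σ τ υ} (𝓔 : EvCxt τ υ) (𝓕 : EvCxt σ τ) Q → (𝓔 ∘ᴱ 𝓕) ⟦ Q ⟧ ≡ 𝓔 ⟦ 𝓕 ⟦ Q ⟧ ⟧
  ∘ᴱ-⟦⟧ □            𝓕 Q = refl
  ∘ᴱ-⟦⟧ (fun f A 𝓔)  𝓕 Q = cong (fun f ∘ fillArgs A) (∘ᴱ-⟦⟧ 𝓔 𝓕 Q)
  ∘ᴱ-⟦⟧ (cond 𝓔 M N) 𝓕 Q = cong (λ L → cond L M N) (∘ᴱ-⟦⟧ 𝓔 𝓕 Q)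
  ∘ᴱ-⟦⟧ (𝓔 · M)      𝓕 Q = cong (_· M) (∘ᴱ-⟦⟧ 𝓔 𝓕 Q)
  ∘ᴱ-⟦⟧ ⟨ 𝓔 , N ⟩ˡ   𝓕 Q = cong ⟨_, N ⟩ (∘ᴱ-⟦⟧ 𝓔 𝓕 Q)
  ∘ᴱ-⟦⟧ ⟨ V , 𝓔 ⟩ʳ   𝓕 Q = cong ⟨ ⌜ V ⌝ ,_⟩ (∘ᴱ-⟦⟧ 𝓔 𝓕 Q)
  ∘ᴱ-⟦⟧ (fst 𝓔)      𝓕 Q = cong fst (∘ᴱ-⟦⟧ 𝓔 𝓕 Q)
  ∘ᴱ-⟦⟧ (snd 𝓔)      𝓕 Q = cong snd (∘ᴱ-⟦⟧ 𝓔 𝓕 Q)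
  ∘ᴱ-⟦⟧ (appˡ 𝓔 N)   𝓕 Q = cong (λ M → app M N) (∘ᴱ-⟦⟧ 𝓔 𝓕 Q)
  ∘ᴱ-⟦⟧ (appʳ M 𝓔)   𝓕 Q = cong (app (lam M)) (∘ᴱ-⟦⟧ 𝓔 𝓕 Q)

  -- Every value occurring in the effect value satisfies P.
  Leaves : ∀ {σ} → (Val σ → Set) → EffVal σ → Set
  Leaves P (val V)       = P V
  Leaves P (E or F)      = Leaves P E × Leaves P F
  Leaves P (c · E)       = Leaves P E
  Leaves P (E +⟨ p ⟩ F)  = Leaves P E × Leaves P F

  Norm : ∀ {σ} → (Val σ → Set) → Program σ → Set
  Norm P M = ∃[ E ] (M ⇓ E) × Leaves P E

  Red : ∀ σ → Val σ → Set
  Red (base b) V           = ⊤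
  Red unit     V           = ⊤
  Red (σ `× τ) ⟨ V , W ⟩   = Red σ V × Red τ W
  Red (σ ⇒ τ)  (lam M)     = ∀ V → Red σ V → Norm (Red τ) (M [ ⌜ V ⌝ ])

  norm-val : ∀ {σ} {P : Val σ → Set} V → P V → Norm P ⌜ V ⌝
  norm-val V p = val V , ⇓-val V , p

  norm-cxt : ∀ {σ τ} {P : Val τ → Set} (𝓔 : EvCxt σ τ) {Q Q′} →
             Q ⟶ᵣ Q′ → Norm P (𝓔 ⟦ Q′ ⟧) → Norm P (𝓔 ⟦ Q ⟧)
  norm-cxt 𝓔 r (E , d , l) = E , ⇓-step (cxt 𝓔 r) d , l

  norm-step : ∀ {σ} {P : Val σ → Set} {Q Q′} → Q ⟶ᵣ Q′ → Norm P Q′ → Norm P Q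
  norm-step = norm-cxt □

  norm-or : ∀ {σ τ} {P : Val τ → Set} (𝓔 : EvCxt σ τ) {M₁ M₂} →
            Norm P (𝓔 ⟦ M₁ ⟧) → Norm P (𝓔 ⟦ M₂ ⟧) → Norm P (𝓔 ⟦ M₁ or M₂ ⟧)
  norm-or 𝓔 (E₁ , d₁ , l₁) (E₂ , d₂ , l₂) = E₁ or E₂ , ⇓-or 𝓔 d₁ d₂ , l₁ , l₂

  norm-+ : ∀ {σ τ} {P : Val τ → Set} (𝓔 : EvCxt σ τ) {M₁ M₂ p} →
           Norm P (𝓔 ⟦ M₁ ⟧) → Norm P (𝓔 ⟦ M₂ ⟧) → Norm P (𝓔 ⟦ M₁ +⟨ p ⟩ M₂ ⟧)
  norm-+ 𝓔 (E₁ , d₁ , l₁) (E₂ , d₂ , l₂) = E₁ +⟨ _ ⟩ E₂ , ⇓-+ 𝓔 d₁ d₂ , l₁ , l₂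

  norm-· : ∀ {σ τ} {P : Val τ → Set} (𝓔 : EvCxt σ τ) {c M} →
           Norm P (𝓔 ⟦ M ⟧) → Norm P (𝓔 ⟦ con c · M ⟧)
  norm-· 𝓔 (E , d , l) = _ · E , ⇓-· 𝓔 d , l

  bind⇓ : ∀ {σ τ} {P : Val σ → Set} {Q : Val τ → Set} (𝓔 : EvCxt σ τ) {M E} →
          M ⇓ E → Leaves P E → (∀ V → P V → Norm Q (𝓔 ⟦ ⌜ V ⌝ ⟧)) → Norm Q (𝓔 ⟦ M ⟧)
  bind⇓ 𝓔 (⇓-val V) l k = k V l
  bind⇓ {Q = Q} 𝓔 (⇓-step (cxt 𝓕 r) d) l k =
    subst (Norm Q) (∘ᴱ-⟦⟧ 𝓔 𝓕 _)
      (norm-cxt (𝓔 ∘ᴱ 𝓕) r (subst (Norm Q) (sym (∘ᴱ-⟦⟧ 𝓔 𝓕 _)) (bind⇓ 𝓔 d l k)))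
  bind⇓ {Q = Q} 𝓔 (⇓-or 𝓕 d₁ d₂) (l₁ , l₂) k =
    subst (Norm Q) (∘ᴱ-⟦⟧ 𝓔 𝓕 _)
      (norm-or (𝓔 ∘ᴱ 𝓕) (subst (Norm Q) (sym (∘ᴱ-⟦⟧ 𝓔 𝓕 _)) (bind⇓ 𝓔 d₁ l₁ k))
                        (subst (Norm Q) (sym (∘ᴱ-⟦⟧ 𝓔 𝓕 _)) (bind⇓ 𝓔 d₂ l₂ k)))
  bind⇓ {Q = Q} 𝓔 (⇓-+ 𝓕 d₁ d₂) (l₁ , l₂) k =
    subst (Norm Q) (∘ᴱ-⟦⟧ 𝓔 𝓕 _)
      (norm-+ (𝓔 ∘ᴱ 𝓕) (subst (Norm Q) (sym (∘ᴱ-⟦⟧ 𝓔 𝓕 _)) (bind⇓ 𝓔 d₁ l₁ k))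
                       (subst (Norm Q) (sym (∘ᴱ-⟦⟧ 𝓔 𝓕 _)) (bind⇓ 𝓔 d₂ l₂ k)))
  bind⇓ {Q = Q} 𝓔 (⇓-· 𝓕 d) l k =
    subst (Norm Q) (∘ᴱ-⟦⟧ 𝓔 𝓕 _)
      (norm-· (𝓔 ∘ᴱ 𝓕) (subst (Norm Q) (sym (∘ᴱ-⟦⟧ 𝓔 𝓕 _)) (bind⇓ 𝓔 d l k)))

  bind : ∀ {σ τ} {P : Val σ → Set} {Q : Val τ → Set} (𝓔 : EvCxt σ τ) {M} →
         Norm P M → (∀ V → P V → Norm Q (𝓔 ⟦ ⌜ V ⌝ ⟧)) → Norm Q (𝓔 ⟦ M ⟧)
  bind 𝓔 (_ , d , l) k = bind⇓ 𝓔 d l k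

  NormArgs : ∀ {bs} → Args [] bs → Set
  NormArgs []       = ⊤
  NormArgs (M ∷ Ms) = Norm (λ _ → ⊤) M × NormArgs Ms

  -- w and W prefix arguments that are already evaluated.
  norm-args : ∀ {bs b bs′} (f : Fun bs b)
              (w : Args [] bs′ → Args [] bs) (W : ∀ {b′} → ArgsCxt bs′ b′ → ArgsCxt bs b′) →
              (∀ {b′} (A : ArgsCxt bs′ b′) Q → fillArgs (W A) Q ≡ w (fillArgs A Q)) →
              (∀ (cs : All Const bs′) → Norm (Red (base b)) (fun f (w (All.map con cs)))) →
              (Ms : Args [] bs′) → NormArgs Ms → Norm (Red (base b)) (fun f (w Ms))
  norm-args f w W eq k [] _ = k []
  norm-args {b = b} f w W eq k (M ∷ Ms) (n , ns) =
    subst (Norm (Red (base b)) ∘ fun f) (eq (hole Ms) M)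
      (bind (fun f (W (hole Ms)) □) n λ where
        (con c) _ → subst (Norm (Red (base b)) ∘ fun f) (sym (eq (hole Ms) (con c)))
          (norm-args f (w ∘ (con c ∷_)) (W ∘ (c ∷_)) (λ A Q → eq (c ∷ A) Q)
            (k ∘ (c ∷_)) Ms ns))

  RedSub : ∀ {Γ} → Sub Γ [] → Set
  RedSub {Γ} θ = ∀ {σ} (x : σ ∈ Γ) → ∃[ V ] θ x ≡ ⌜ V ⌝ × Red σ V

  mutual
    norm : ∀ {Γ σ} (M : Term Γ σ) (θ : Sub Γ []) → RedSub θ → Norm (Red σ) (sub θ M)
    norm (var x) θ h with θ x | h x
    ... | _ | V , refl , r = norm-val V r
    norm (con c) θ h = norm-val (con c) tt
    norm (fun f Ms) θ h = norm-args f id id (λ _ _ → refl)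
      (λ cs → norm-step (δ-fun f cs) (norm-val (con (valᶠ f cs)) tt)) (subArgs θ Ms) (normArgs Ms θ h)
    norm (cond L M N) θ h = bind (cond □ (sub θ M) (sub θ N)) (norm L θ h) branch
      where
      branch : ∀ V → ⊤ → Norm (Red _) (cond ⌜ V ⌝ (sub θ M) (sub θ N))
      branch (con c) _ with bool-canonical c
      ... | inj₁ refl = norm-step if-tt (norm M θ h)
      ... | inj₂ refl = norm-step if-ff (norm N θ h)
    norm (M or N) θ h = norm-or □ (norm M θ h) (norm N θ h)
    norm (N · M) θ h = bind (□ · sub θ M) (norm N θ h) λ where
      (con c) _ → norm-· □ (norm M θ h)
    norm (M +⟨ p ⟩ N) θ h = norm-+ □ (norm M θ h) (norm N θ h)
    norm ⋆ θ h = norm-val ⋆ tt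
    norm ⟨ M , N ⟩ θ h =
      bind ⟨ □ , sub θ N ⟩ˡ (norm M θ h) λ V r →
      bind ⟨ V , □ ⟩ʳ (norm N θ h) λ W s →
      norm-val ⟨ V , W ⟩ (r , s)
    norm (fst M) θ h = bind (fst □) (norm M θ h) λ where
      ⟨ V , W ⟩ (r , _) → norm-step (fst-β V W) (norm-val V r)
    norm (snd M) θ h = bind (snd □) (norm M θ h) λ where
      ⟨ V , W ⟩ (_ , s) → norm-step (snd-β V W) (norm-val W s)
    norm (lam M) θ h = norm-val (lam (sub (extˢ θ) M)) λ V r →
      subst (Norm (Red _)) (sym (ext-[] θ M ⌜ V ⌝))
        (norm M (θ ,ˢ ⌜ V ⌝) λ where (here refl) → V , refl , r
                                     (there x)   → h x)
    norm (app M N) θ h = bind (appˡ □ (sub θ N)) (norm M θ h) λ where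
      (lam L) k → bind (appʳ L □) (norm N θ h) λ V r → norm-step (app-β L V) (k V r)

    normArgs : ∀ {Γ bs} (Ms : Args Γ bs) (θ : Sub Γ []) → RedSub θ → NormArgs (subArgs θ Ms)
    normArgs []       θ h = tt
    normArgs (M ∷ Ms) θ h = norm M θ h , normArgs Ms θ h

  ⇓-total : ∀ {σ} (M : Program σ) → ∃[ E ] (M ⇓ E)
  ⇓-total M with norm M var (λ ())
  ... | E , d , _ = E , subst (_⇓ E) (sub-id (λ ()) M) d

module Selection {ℜ : Reals} {Sg : Signature ℜ} {ℛ : Rewards ℜ}
                 (I : Interpretation Sg ℛ) where
  open Convexity ℜ
  open Signature Sg using (Const)
  open Rewards ℛ
  open Interpretation I
  open Language Sg
  open Normalisation I using (⇓-total)

  Op : ∀ {σ} → Program σ → EffVal σ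
  Op M = proj₁ (⇓-total M)

  DW : Set → Set
  DW X = Dist (R × X)

  infixr 7 _·ᴰ_
  _·ᴰ_ : {X : Set} → R → DW X → DW X
  r ·ᴰ μ = mapᴰ (λ (s , x) → r +ᴿ s , x) μ

  𝐄 : {X : Set} → DW X → R
  𝐄 μ = ∑ _+⟨_⟩ᴿ_ μ proj₁

  Str : ∀ {σ} → EffVal σ → Set
  Str (val V)      = ⊤
  Str (E or F)     = Str E ⊎ Str F
  Str (c · E)      = Str E
  Str (E +⟨ p ⟩ F) = Str E × Str F

  Out : ∀ {σ} (E : EffVal σ) → Str E → DW (Val σ)
  Out (val V)      _        = dirac (0ᴿ , V)
  Out (E or F)     (inj₁ s) = Out E s
  Out (E or F)     (inj₂ s) = Out F s
  Out (c · E)      s        = ⟦ c ⟧ᶜ ·ᴰ Out E s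
  Out (E +⟨ p ⟩ F) (s , t)  = mix (Out E s) p (Out F t)

  Rew : ∀ {σ} (E : EffVal σ) → Str E → R
  Rew E s = 𝐄 (Out E s)

  Before : ∀ {σ} (E : EffVal σ) → Str E → Str E → Set
  Before (val V)      _         _         = ⊥
  Before (E or F)     (inj₁ s)  (inj₁ s′) = Before E s s′
  Before (E or F)     (inj₁ s)  (inj₂ t)  = ⊤
  Before (E or F)     (inj₂ t)  (inj₁ s)  = ⊥
  Before (E or F)     (inj₂ t)  (inj₂ t′) = Before F t t′
  Before (c · E)      s         s′        = Before E s s′
  Before (E +⟨ p ⟩ F) (s , t)   (s′ , t′) = Before E s s′ ⊎ (s ≡ s′ × Before F t t′)

  Maximal : ∀ {σ} (E : EffVal σ) → (Str E → R) → Str E → Set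
  Maximal E f s = ∀ t → f t ≤ᴿ f s

  LeastMaximal : ∀ {σ} (E : EffVal σ) → (Str E → R) → Str E → Set
  LeastMaximal E f s = Maximal E f s × (∀ t → Maximal E f t → s ≡ t ⊎ Before E s t)

  leastMaximal : ∀ {σ} (E : EffVal σ) (f : Str E → R) → ∃[ s ] LeastMaximal E f s
  leastMaximal (val V) f = tt , (λ _ → ≤ᴿ-refl) , λ _ _ → inj₁ refl
  leastMaximal (E or F) f
    with leastMaximal E (f ∘ inj₁) | leastMaximal F (f ∘ inj₂)
  ... | a , maxᵃ , leastᵃ | b , maxᵇ , leastᵇ with f (inj₂ b) ≤ᴿ? f (inj₁ a)
  ... | yes fb≤fa = inj₁ a , max , least
    where
    max : Maximal (E or F) f (inj₁ a)
    max (inj₁ s) = maxᵃ s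
    max (inj₂ t) = ≤ᴿ-trans (maxᵇ t) fb≤fa
    least : ∀ t → Maximal (E or F) f t → inj₁ a ≡ t ⊎ Before (E or F) (inj₁ a) t
    least (inj₁ s) m with leastᵃ s (m ∘ inj₁)
    ... | inj₁ refl = inj₁ refl
    ... | inj₂ a<s  = inj₂ a<s
    least (inj₂ t) m = inj₂ tt
  ... | no  fb≰fa = inj₂ b , max , least
    where
    fa≤fb : f (inj₁ a) ≤ᴿ f (inj₂ b)
    fa≤fb with ≤ᴿ-total (f (inj₁ a)) (f (inj₂ b))
    ... | inj₁ le = le
    ... | inj₂ ge = ⊥-elim (fb≰fa ge)
    max : Maximal (E or F) f (inj₂ b)
    max (inj₁ s) = ≤ᴿ-trans (maxᵃ s) fa≤fb
    max (inj₂ t) = maxᵇ t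
    least : ∀ t → Maximal (E or F) f t → inj₂ b ≡ t ⊎ Before (E or F) (inj₂ b) t
    least (inj₁ s) m = ⊥-elim (fb≰fa (≤ᴿ-trans (m (inj₂ b)) (maxᵃ s)))
    least (inj₂ t) m with leastᵇ t (m ∘ inj₂)
    ... | inj₁ refl = inj₁ refl
    ... | inj₂ b<t  = inj₂ b<t
  leastMaximal (c · E) f = leastMaximal E f
  leastMaximal (E +⟨ p ⟩ F) f = (a , b a) , max , least
    where
    b : Str E → Str F
    b s = proj₁ (leastMaximal F (λ t → f (s , t)))
    b-ok : ∀ s → LeastMaximal F (λ t → f (s , t)) (b s)
    b-ok s = proj₂ (leastMaximal F (λ t → f (s , t)))
    g : Str E → R
    g s = f (s , b s)
    a : Str E
    a = proj₁ (leastMaximal E g)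
    a-ok : LeastMaximal E g a
    a-ok = proj₂ (leastMaximal E g)
    max : Maximal (E +⟨ p ⟩ F) f (a , b a)
    max (s , t) = ≤ᴿ-trans (proj₁ (b-ok s) t) (proj₁ a-ok s)
    least : ∀ st → Maximal (E +⟨ p ⟩ F) f st →
            (a , b a) ≡ st ⊎ Before (E +⟨ p ⟩ F) (a , b a) st
    least (s , t) m
      with proj₂ a-ok s (λ s′ → ≤ᴿ-trans (m (s′ , b s′)) (proj₁ (b-ok s) t))
    ... | inj₂ a<s  = inj₂ (inj₁ a<s)
    ... | inj₁ refl with proj₂ (b-ok a) t (λ t′ → m (a , t′))
    ... | inj₁ ba≡t = inj₁ (cong (a ,_) ba≡t)
    ... | inj₂ ba<t = inj₂ (inj₂ (refl , ba<t))

  -- The first component of leastMaximal is determined by the second, Before being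
  -- a strict total order.
  s-opt : ∀ {σ} (E : EffVal σ) → Str E
  s-opt E = proj₁ (leastMaximal E (Rew E))

  Opₛ : ∀ {σ} → Program σ → DW (Val σ)
  Opₛ M = Out (Op M) (s-opt (Op M))

record AuxMonad {ℜ : Reals} (ℛ : Rewards ℜ) : Set₁ where
  open Convexity ℜ
  open Rewards ℛ
  infix 10 _†
  field
    T           : Set → Set
    η           : {X : Set} → X → T X
    _†          : {X Y : Set} → (X → T Y) → T X → T Y
    †-η         : {X Y : Set} (f : X → T Y) (x : X) → (f †) (η x) ≡ f x
    η-†         : {X : Set} (u : T X) → (η †) u ≡ u
    †-†         : {X Y Z : Set} (g : Y → T Z) (f : X → T Y) (u : T X) →
                  (g †) ((f †) u) ≡ ((g † ∘ f) †) u

  mapᵀ : {X Y : Set} → (X → Y) → T X → T Y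
  mapᵀ f = (η ∘ f) †

  field
    _·ᵀ_        : {X : Set} → R → T X → T X
    _+⟨_⟩ᵀ_     : {X : Set} → T X → 𝕀 → T X → T X
    ·-algebraic : {X Y : Set} (f : X → T Y) (r : R) (u : T X) →
                  (f †) (r ·ᵀ u) ≡ r ·ᵀ (f †) u
    +-algebraic : {X Y : Set} (f : X → T Y) (p : 𝕀) (u v : T X) →
                  (f †) (u +⟨ p ⟩ᵀ v) ≡ (f †) u +⟨ p ⟩ᵀ (f †) v
    α           : T R → R
    α-η         : ∀ r → α (η r) ≡ r
    α-μ         : (u : T (T R)) → α ((id †) u) ≡ α (mapᵀ α u)
    isModule    : {X : Set} → IsBarycentricModule ℛ (_·ᵀ_ {X}) _+⟨_⟩ᵀ_
    α-·         : ∀ r u → α (r ·ᵀ u) ≡ r +ᴿ α u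
    α-+         : ∀ p u v → α (u +⟨ p ⟩ᵀ v) ≡ α u +⟨ p ⟩ᴿ α v

module Denotation {ℜ : Reals} {Sg : Signature ℜ} {ℛ : Rewards ℜ}
                  (I : Interpretation Sg ℛ) (𝕋 : AuxMonad ℛ) where
  open Convexity ℜ
  open Signature Sg
  open Rewards ℛ
  open Interpretation I
  open Language Sg
  open Selection I using (DW)
  open AuxMonad 𝕋

  S : Set → Set
  S X = (X → R) → T X

  𝐑 : {X : Set} → S X → (X → R) → R
  𝐑 F γ = α (mapᵀ γ (F γ))

  ηˢ : {X : Set} → X → S X
  ηˢ x γ = η x

  infix 10 _†ˢ
  _†ˢ : {X Y : Set} → (X → S Y) → S X → S Y
  (f †ˢ) F γ = ((λ x → f x γ) †) (F (λ x → 𝐑 (f x) γ))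

  _orˢ_ : {X : Set} → S X → S X → S X
  (G₀ orˢ G₁) γ = if does (𝐑 G₁ γ ≤ᴿ? 𝐑 G₀ γ) then G₀ γ else G₁ γ

  _·ˢ_ : {X : Set} → R → S X → S X
  (r ·ˢ G) γ = r ·ᵀ G γ

  _+⟨_⟩ˢ_ : {X : Set} → S X → 𝕀 → S X → S X
  (F +⟨ p ⟩ˢ G) γ = F γ +⟨ p ⟩ᵀ G γ

  𝒮⟦_⟧ᵗ : Type → Set
  𝒮⟦ base b ⟧ᵗ = ⟦ b ⟧ᵇ
  𝒮⟦ unit ⟧ᵗ   = ⊤
  𝒮⟦ σ `× τ ⟧ᵗ = 𝒮⟦ σ ⟧ᵗ × 𝒮⟦ τ ⟧ᵗ
  𝒮⟦ σ ⇒ τ ⟧ᵗ  = 𝒮⟦ σ ⟧ᵗ → S 𝒮⟦ τ ⟧ᵗ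

  Env : Ctx → Set
  Env = All 𝒮⟦_⟧ᵗ

  mutual
    𝒮⟦_⟧ : ∀ {Γ σ} → Term Γ σ → Env Γ → S 𝒮⟦ σ ⟧ᵗ
    𝒮⟦ var x ⟧ ρ      = ηˢ (All.lookup ρ x)
    𝒮⟦ con c ⟧ ρ      = ηˢ ⟦ c ⟧ᶜ
    𝒮⟦ fun f Ms ⟧ ρ   = ((λ as → ηˢ (⟦ f ⟧ᶠ as)) †ˢ) (𝒮⟦ Ms ⟧ᵃ ρ)
    𝒮⟦ cond L M N ⟧ ρ = ((λ b → if b then 𝒮⟦ M ⟧ ρ else 𝒮⟦ N ⟧ ρ) †ˢ) (𝒮⟦ L ⟧ ρ)
    𝒮⟦ M or N ⟧ ρ     = 𝒮⟦ M ⟧ ρ orˢ 𝒮⟦ N ⟧ ρ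
    𝒮⟦ N · M ⟧ ρ      = ((λ r → r ·ˢ 𝒮⟦ M ⟧ ρ) †ˢ) (𝒮⟦ N ⟧ ρ)
    𝒮⟦ M +⟨ p ⟩ N ⟧ ρ = 𝒮⟦ M ⟧ ρ +⟨ p ⟩ˢ 𝒮⟦ N ⟧ ρ
    𝒮⟦ ⋆ ⟧ ρ          = ηˢ tt
    𝒮⟦ ⟨ M , N ⟩ ⟧ ρ  = ((λ a → ((λ b → ηˢ (a , b)) †ˢ) (𝒮⟦ N ⟧ ρ)) †ˢ) (𝒮⟦ M ⟧ ρ)
    𝒮⟦ fst M ⟧ ρ      = ((ηˢ ∘ proj₁) †ˢ) (𝒮⟦ M ⟧ ρ)
    𝒮⟦ snd M ⟧ ρ      = ((ηˢ ∘ proj₂) †ˢ) (𝒮⟦ M ⟧ ρ)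
    𝒮⟦ lam M ⟧ ρ      = ηˢ (λ a → 𝒮⟦ M ⟧ (a ∷ ρ))
    𝒮⟦ app M N ⟧ ρ    = ((λ g → (g †ˢ) (𝒮⟦ N ⟧ ρ)) †ˢ) (𝒮⟦ M ⟧ ρ)

    𝒮⟦_⟧ᵃ : ∀ {Γ bs} → Args Γ bs → Env Γ → S (All ⟦_⟧ᵇ bs)
    𝒮⟦ [] ⟧ᵃ ρ     = ηˢ []
    𝒮⟦ M ∷ Ms ⟧ᵃ ρ = ((λ a → ((λ as → ηˢ (a ∷ as)) †ˢ) (𝒮⟦ Ms ⟧ᵃ ρ)) †ˢ) (𝒮⟦ M ⟧ ρ)

  𝒮ₚ⟦_⟧ : ∀ {σ} → Val σ → 𝒮⟦ σ ⟧ᵗ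
  𝒮ₚ⟦ con c ⟧     = ⟦ c ⟧ᶜ
  𝒮ₚ⟦ ⋆ ⟧         = tt
  𝒮ₚ⟦ ⟨ V , W ⟩ ⟧ = 𝒮ₚ⟦ V ⟧ , 𝒮ₚ⟦ W ⟧
  𝒮ₚ⟦ lam N ⟧     = λ a → 𝒮⟦ N ⟧ (a ∷ [])

  𝒮⟦_⟧₀ : ∀ {σ} → Program σ → S 𝒮⟦ σ ⟧ᵗ
  𝒮⟦ M ⟧₀ = 𝒮⟦ M ⟧ []

  ⟦_⟧ᵀ : ∀ {σ} → DW (Val σ) → T 𝒮⟦ σ ⟧ᵗ
  ⟦ μ ⟧ᵀ = ∑ _+⟨_⟩ᵀ_ μ (λ (r , V) → r ·ᵀ η 𝒮ₚ⟦ V ⟧)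

{-# OPTIONS --safe #-}
module Submission where

-- Under a fixed reward function γ, the extension f †ˢ evaluates its argument at a
-- reward function γ′ for which 𝐑 (f †ˢ F) γ = 𝐑 F γ′.  So f †ˢ commutes with or, and by
-- algebraicity with the other two operations; hence so does every evaluation context,
-- and M ⇓ E implies that M denotes the effect value E.  For effect values at γ = 0, the
-- reward 𝐑 of the denotation is the reward of the optimal strategy, so that or makes
-- the same choice on both sides, ties going to the left.  The optimal strategy of
-- c · E or E +⟨ p ⟩ F is made up of those of the parts, as adding a reward and, when
-- 0 < p < 1, mixing reflect the order of R.

open import Defs
open import Algebra.Bundles using (CommutativeRing)
open import Algebra.Structures using (IsCommutativeMonoid)
open import Axiom.Extensionality.Propositional using (Extensionality)
open import Data.Bool.Base using (Bool; if_then_else_)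
open import Data.Bool.Properties using (if-float)
open import Data.Empty using (⊥; ⊥-elim)
open import Data.List.Base using (List; []; _∷_; _++_; map)
open import Data.List.Membership.Propositional using (_∈_)
open import Data.List.NonEmpty.Base as List⁺ using (List⁺; _∷_; _⁺++⁺_)
open import Data.List.NonEmpty.Properties using () renaming (map-cong to map⁺-cong)
open import Data.List.Properties using (map-++; map-∘)
open import Data.List.Relation.Unary.All as All using (All; []; _∷_)
open import Data.List.Relation.Unary.Any using (here; there)
open import Data.Product.Base using (_×_; _,_; proj₁; proj₂)
open import Data.Sum.Base using (_⊎_; inj₁; inj₂)
open import Function.Base using (_∘_; id)
open import Function.Bundles using (_⇔_; Equivalence)
open import Level using (0ℓ)
open import Relation.Binary.PropositionalEquality
  using (_≡_; _≢_; refl; sym; trans; cong; cong₂; subst₂; module ≡-Reasoning)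
open import Relation.Nullary using (yes; no; does)
open import Relation.Nullary.Decidable using (recompute)

-- Cancellation of fractions with nonzero denominators.

module Field (ℜ : Reals) where
  open Reals ℜ
  open RealProperties ℜ
  open import Algebra.Properties.CommutativeSemigroup
    (CommutativeRing.*-commutativeSemigroup commutativeRing) using (x∙yz≈y∙xz)
  open ≡-Reasoning

  [x/y]*y≡x : ∀ x {y} → y ≢ 0# → x / y * y ≡ x
  [x/y]*y≡x x {y} y≢0 = begin
    x * y ⁻¹ * y    ≡⟨ *-assoc x (y ⁻¹) y ⟩
    x * (y ⁻¹ * y)  ≡⟨ cong (x *_) (trans (*-comm (y ⁻¹) y) (*-inverseʳ y y≢0)) ⟩
    x * 1#          ≡⟨ *-identityʳ x ⟩
    x               ∎

  [x*y]/y≡x : ∀ x {y} → y ≢ 0# → x * y / y ≡ x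
  [x*y]/y≡x x {y} y≢0 = begin
    x * y * y ⁻¹    ≡⟨ *-assoc x y (y ⁻¹) ⟩
    x * (y * y ⁻¹)  ≡⟨ cong (x *_) (*-inverseʳ y y≢0) ⟩
    x * 1#          ≡⟨ *-identityʳ x ⟩
    x               ∎

  [x/y]*[y/z]≡x/z : ∀ x {y} z → y ≢ 0# → x / y * (y / z) ≡ x / z
  [x/y]*[y/z]≡x/z x {y} z y≢0 =
    trans (sym (*-assoc (x / y) y (z ⁻¹))) (cong (_/ z) ([x/y]*y≡x x y≢0))

  x/z≢0 : ∀ {x z} → x ≢ 0# → z ≢ 0# → x / z ≢ 0#
  x/z≢0 {x} {z} x≢0 z≢0 x/z≡0 =
    x≢0 (trans (sym ([x/y]*y≡x x z≢0)) (trans (cong (_* z) x/z≡0) (zeroˡ z)))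

  x*y≢0 : ∀ {x y} → x ≢ 0# → y ≢ 0# → x * y ≢ 0#
  x*y≢0 {x} {y} x≢0 y≢0 xy≡0 =
    x≢0 (trans (sym ([x*y]/y≡x x y≢0)) (trans (cong (_/ y) xy≡0) (zeroˡ (y ⁻¹))))

  [z*x]/[z*y]≡x/y : ∀ {z} x {y} → z ≢ 0# → y ≢ 0# → (z * x) / (z * y) ≡ x / y
  [z*x]/[z*y]≡x/y {z} x {y} z≢0 y≢0 = begin
    (z * x) / (z * y)            ≡⟨ cong (λ w → (z * w) / (z * y)) ([x/y]*y≡x x y≢0) ⟨
    (z * (x / y * y)) / (z * y)  ≡⟨ cong (_/ (z * y)) (x∙yz≈y∙xz z (x / y) y) ⟩
    (x / y * (z * y)) / (z * y)  ≡⟨ [x*y]/y≡x (x / y) (x*y≢0 z≢0 y≢0) ⟩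
    x / y                        ∎

  x+y≡0⇒x≡0 : ∀ {x y} → 0# ≤ x → 0# ≤ y → x + y ≡ 0# → x ≡ 0#
  x+y≡0⇒x≡0 {x} {y} 0≤x 0≤y x+y≡0 =
    antisym (subst₂ _≤_ (+-identityʳ x) x+y≡0 (+-monoʳ-≤ x 0≤y)) 0≤x

  x+y≡0⇒y≡0 : ∀ {x y} → 0# ≤ x → 0# ≤ y → x + y ≡ 0# → y ≡ 0#
  x+y≡0⇒y≡0 {x} {y} 0≤x 0≤y x+y≡0 = x+y≡0⇒x≡0 0≤y 0≤x (trans (+-comm y x) x+y≡0)

  1-x≡0⇒x≡1 : ∀ {x} → 1# - x ≡ 0# → x ≡ 1#
  1-x≡0⇒x≡1 {x} 1-x≡0 =
    trans (sym (+-identityʳ x)) (trans (cong (x +_) (sym 1-x≡0)) (x+[y-x]≡y x 1#))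

  1-x≡1⇒x≡0 : ∀ {x} → 1# - x ≡ 1# → x ≡ 0#
  1-x≡1⇒x≡0 {x} 1-x≡1 = begin
    x                        ≡⟨ [x+y]-x≡y (1# - x) x ⟨
    (1# - x) + x - (1# - x)  ≡⟨ cong₂ _-_ (trans (+-comm (1# - x) x) (x+[y-x]≡y x 1#)) 1-x≡1 ⟩
    1# - 1#                  ≡⟨ -‿inverseʳ 1# ⟩
    0#                       ∎

  1-x/[x+y]≡y/[x+y] : ∀ x y → x + y ≢ 0# → 1# - x / (x + y) ≡ y / (x + y)
  1-x/[x+y]≡y/[x+y] x y x+y≢0 = begin
    1# - x / (x + y)                 ≡⟨ cong (_- x / (x + y)) (*-inverseʳ (x + y) x+y≢0) ⟨
    (x + y) / (x + y) - x / (x + y)  ≡⟨ [y-z]x≈yx-zx ((x + y) ⁻¹) (x + y) x ⟨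
    (x + y - x) / (x + y)            ≡⟨ cong (_/ (x + y)) ([x+y]-x≡y x y) ⟩
    y / (x + y)                      ∎

-- Finite convex combinations in barycentric algebras.

module Barycentric (ℜ : Reals) where
  open Reals ℜ
  open RealProperties ℜ
  open Field ℜ
  open Convexity ℜ
  open ≡-Reasoning

  val-injective : ∀ {p q} → val p ≡ val q → p ≡ q
  val-injective {mk𝕀 _ _ _} {mk𝕀 _ _ _} refl = refl

  -- The bounds are irrelevant arguments, so ratios of the same numbers agree whatever the proofs,
  -- and `share p xs` is definitionally the ratio of `val p` and `mass xs`.
  ratio : ∀ a b → .(0# ≤ a) → .(0# ≤ b) → 𝕀
  ratio a b 0≤a 0≤b =
    mk𝕀 (a / (a + b)) (proj₁ (a/[a+b]-bounds 0≤a 0≤b)) (proj₂ (a/[a+b]-bounds 0≤a 0≤b))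

  onPoint : {A B : Set} → (A → B) → 𝕀 × A → 𝕀 × B
  onPoint f (p , x) = p , f x

  onWeight : {A : Set} → 𝕀 → 𝕀 × A → 𝕀 × A
  onWeight q (p , x) = q *ᴵ p , x

  -- The common factor `q` cancels from numerator and denominator. This is where a factor 0 has to
  -- be excluded.
  share-scale : ∀ {A : Set} q → 0< q → ∀ p (xs : List (𝕀 × A)) →
    share (q *ᴵ p) (map (onWeight q) xs) ≡ share p xs
  share-scale q q≢0 p xs =
    val-injective (trans (cong (λ w → val q * a / (val q * a + w)) (mass-scale q xs)) scaled)
    where
    a b : ℝ
    a = val p
    b = mass xs
    scaled : val q * a / (val q * a + val q * b) ≡ a / (a + b)
    scaled with (a + b) ≟ 0#
    -- Both numerators vanish, so both fractions are 0 whatever value `_⁻¹` takes at `0#`.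
    ... | yes a+b≡0 = begin
      val q * a / w    ≡⟨ cong (λ u → val q * u / w) a≡0 ⟩
      val q * 0# / w   ≡⟨ cong (_/ w) (zeroʳ (val q)) ⟩
      0# / w           ≡⟨ zeroˡ (w ⁻¹) ⟩
      0#               ≡⟨ zeroˡ ((a + b) ⁻¹) ⟨
      0# / (a + b)     ≡⟨ cong (_/ (a + b)) a≡0 ⟨
      a / (a + b)      ∎
      where
      w : ℝ
      w = val q * a + val q * b
      a≡0 : a ≡ 0#
      a≡0 = x+y≡0⇒x≡0 (0≤val p) (mass-nonNeg xs) a+b≡0
    ... | no a+b≢0 = trans (cong (val q * a /_) (sym (distribˡ (val q) a b)))
                           ([z*x]/[z*y]≡x/y a q≢0 a+b≢0)

  combineFrom-scale : ∀ {A : Set} {_⊕⟨_⟩_ : A → 𝕀 → A → A} q → 0< q → ∀ p x xs →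
    combineFrom _⊕⟨_⟩_ (q *ᴵ p , x) (map (onWeight q) xs) ≡
    combineFrom _⊕⟨_⟩_ (p , x) xs
  combineFrom-scale q q≢0 p x []               = refl
  combineFrom-scale {_⊕⟨_⟩_ = _⊕⟨_⟩_} q q≢0 p x ((r , y) ∷ xs) =
    cong₂ (x ⊕⟨_⟩_) (share-scale q q≢0 p ((r , y) ∷ xs)) (combineFrom-scale q q≢0 r y xs)

  map-scale : ∀ {A B : Set} (f : A → B) q (xs : List (𝕀 × A)) →
    map (onPoint f) (map (onWeight q) xs) ≡ map (onWeight q) (map (onPoint f) xs)
  map-scale f q xs =
    trans (sym (map-∘ {g = onPoint f} {onWeight q} xs)) (map-∘ {g = onWeight q} {onPoint f} xs)

  -- The proof stored in a `Dist` is irrelevant; decidable equality of reals makes it usable again.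
  mass⁺≡1 : ∀ {A : Set} (μ : Dist A) → mass⁺ (points μ) ≡ 1#
  mass⁺≡1 (mkDist xs m≡1) = recompute (mass⁺ xs ≟ 1#) m≡1

  -- The shares depend on the weights alone, and `h` acts on the points alone. Applied below to
  -- adding a reward, to the action of `R` and to taking rewards.
  combineFrom-hom : ∀ {A B : Set} {_⊕⟨_⟩_ : A → 𝕀 → A → A} {_⊞⟨_⟩_ : B → 𝕀 → B → B} (h : A → B) →
    (∀ p x y → h (x ⊕⟨ p ⟩ y) ≡ h x ⊞⟨ p ⟩ h y) → ∀ p x xs →
    h (combineFrom _⊕⟨_⟩_ (p , x) xs) ≡
    combineFrom _⊞⟨_⟩_ (p , h x) (map (onPoint h) xs)
  combineFrom-hom h hom p x [] = refl
  combineFrom-hom {_⊞⟨_⟩_ = _⊞⟨_⟩_} h hom p x ((q , y) ∷ xs) =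
    trans (hom _ x _) (cong₂ (h x ⊞⟨_⟩_)
      (val-injective (cong (λ w → val p / (val p + w)) (sym (mass-map h ((q , y) ∷ xs)))))
      (combineFrom-hom h hom q y xs))

  ∑-hom : ∀ {A B C : Set} {_⊕⟨_⟩_ : A → 𝕀 → A → A} {_⊞⟨_⟩_ : B → 𝕀 → B → B} (h : A → B) →
    (∀ p x y → h (x ⊕⟨ p ⟩ y) ≡ h x ⊞⟨ p ⟩ h y) → ∀ (μ : Dist C) (f : C → A) →
    h (∑ _⊕⟨_⟩_ μ f) ≡ ∑ _⊞⟨_⟩_ μ (h ∘ f)
  ∑-hom {_⊞⟨_⟩_ = _⊞⟨_⟩_} h hom (mkDist ((p , x) ∷ xs) _) f =
    trans (combineFrom-hom h hom p (f x) (map (onPoint f) xs))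
          (cong (combineFrom _⊞⟨_⟩_ (p , h (f x))) (sym (map-∘ {g = onPoint h} {onPoint f} xs)))

  ∑-cong : ∀ {A B : Set} {_⊕⟨_⟩_ : B → 𝕀 → B → B} (μ : Dist A) {f g : A → B} → (∀ x → f x ≡ g x) →
    ∑ _⊕⟨_⟩_ μ f ≡ ∑ _⊕⟨_⟩_ μ g
  ∑-cong {_⊕⟨_⟩_ = _⊕⟨_⟩_} μ f≗g =
    cong (combine _⊕⟨_⟩_) (map⁺-cong (λ (p , x) → cong (p ,_) (f≗g x)) (points μ))

  ∑-mapᴰ : ∀ {A B C : Set} {_⊕⟨_⟩_ : C → 𝕀 → C → C} (g : A → B) (μ : Dist A) (f : B → C) →
    ∑ _⊕⟨_⟩_ (mapᴰ g μ) f ≡ ∑ _⊕⟨_⟩_ μ (f ∘ g)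
  ∑-mapᴰ {_⊕⟨_⟩_ = _⊕⟨_⟩_} g (mkDist ((p , x) ∷ xs) _) f =
    cong (combineFrom _⊕⟨_⟩_ (p , f (g x))) (sym (map-∘ {g = onPoint f} {onPoint g} xs))

  module _ {A : Set} {_⊕⟨_⟩_ : A → 𝕀 → A → A} (isBary : IsBarycentric _⊕⟨_⟩_) where
    open IsBarycentric isBary

    ⊕-one : ∀ {p} x y → val p ≡ 1# → x ⊕⟨ p ⟩ y ≡ x
    ⊕-one x y p≡1 = trans (cong (x ⊕⟨_⟩ y) (val-injective p≡1)) (+-one x y)

    -- Swapping the points by `+-skew` turns weight 0 into weight 1.
    ⊕-zero : ∀ {p} x y → val p ≡ 0# → x ⊕⟨ p ⟩ y ≡ y
    ⊕-zero {p} x y p≡0 = trans (+-skew x y p) (⊕-one y x 1-p≡1)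
      where
      1-p≡1 : 1# - val p ≡ 1#
      1-p≡1 = begin
        1# - val p            ≡⟨ +-identityˡ (1# - val p) ⟨
        0# + (1# - val p)     ≡⟨ cong (_+ (1# - val p)) p≡0 ⟨
        val p + (1# - val p)  ≡⟨ x+[y-x]≡y (val p) 1# ⟩
        1#                    ∎

    -- The zero cases are treated apart, as +-skew-assoc needs both outer weights to
    -- differ from 1 and division by 0# gives no information.
    ratio-assoc : ∀ {a b c} (0≤a : 0# ≤ a) (0≤b : 0# ≤ b) (0≤c : 0# ≤ c) x y z →
      x ⊕⟨ ratio a (b + c) 0≤a (+-nonNeg 0≤b 0≤c) ⟩ (y ⊕⟨ ratio b c 0≤b 0≤c ⟩ z) ≡
      (x ⊕⟨ ratio a b 0≤a 0≤b ⟩ y) ⊕⟨ ratio (a + b) c (+-nonNeg 0≤a 0≤b) 0≤c ⟩ z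
    ratio-assoc {a} {b} {c} 0≤a 0≤b 0≤c x y z with (a + b) ≟ 0# | b ≟ 0# | c ≟ 0#
    ... | yes a+b≡0 | _ | _ = begin
      x ⊕⟨ _ ⟩ (y ⊕⟨ _ ⟩ z)  ≡⟨ ⊕-zero x _ (0/ (x+y≡0⇒x≡0 0≤a 0≤b a+b≡0)) ⟩
      y ⊕⟨ _ ⟩ z             ≡⟨ ⊕-zero y z (0/ (x+y≡0⇒y≡0 0≤a 0≤b a+b≡0)) ⟩
      z                      ≡⟨ ⊕-zero _ z (0/ a+b≡0) ⟨
      (x ⊕⟨ _ ⟩ y) ⊕⟨ _ ⟩ z  ∎
      where
      0/ : ∀ {u v} → u ≡ 0# → u / v ≡ 0#
      0/ {v = v} u≡0 = trans (cong (_/ v) u≡0) (zeroˡ (v ⁻¹))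
    ... | no a+b≢0 | yes refl | _ = begin
      x ⊕⟨ _ ⟩ (y ⊕⟨ _ ⟩ z)  ≡⟨ cong (x ⊕⟨ _ ⟩_) (⊕-zero y z (zeroˡ _)) ⟩
      x ⊕⟨ _ ⟩ z             ≡⟨ cong (x ⊕⟨_⟩ z) (val-injective (cong₂ _/_ (sym (+-identityʳ a))
                                  (sym (+-assoc a 0# c)))) ⟩
      x ⊕⟨ _ ⟩ z             ≡⟨ cong (_⊕⟨ _ ⟩ z) (⊕-one x y a/[a+0]≡1) ⟨
      (x ⊕⟨ _ ⟩ y) ⊕⟨ _ ⟩ z  ∎
      where
      a/[a+0]≡1 : a / (a + 0#) ≡ 1#
      a/[a+0]≡1 = trans (cong (_/ (a + 0#)) (sym (+-identityʳ a))) (*-inverseʳ _ a+b≢0)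
    ... | no a+b≢0 | no b≢0 | yes refl = begin
      x ⊕⟨ _ ⟩ (y ⊕⟨ _ ⟩ z)  ≡⟨ cong (x ⊕⟨ _ ⟩_) (⊕-one y z (w/[w+0]≡1 b≢0)) ⟩
      x ⊕⟨ _ ⟩ y             ≡⟨ cong (x ⊕⟨_⟩ y) (val-injective
                                  (cong (λ w → a / (a + w)) (+-identityʳ b))) ⟩
      x ⊕⟨ _ ⟩ y             ≡⟨ ⊕-one _ z (w/[w+0]≡1 a+b≢0) ⟨
      (x ⊕⟨ _ ⟩ y) ⊕⟨ _ ⟩ z  ∎
      where
      w/[w+0]≡1 : ∀ {w} → w ≢ 0# → w / (w + 0#) ≡ 1#
      w/[w+0]≡1 {w} w≢0 = trans (cong (w /_) (+-identityʳ w)) (*-inverseʳ w w≢0)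
    ... | no a+b≢0 | no b≢0 | no c≢0 = begin
      x ⊕⟨ _ ⟩ (y ⊕⟨ _ ⟩ z)
        ≡⟨ cong (x ⊕⟨_⟩ (y ⊕⟨ ratio b c 0≤b 0≤c ⟩ z))
             (val-injective (trans (cong (a /_) (sym (+-assoc a b c))) (sym PQ≡))) ⟩
      x ⊕⟨ _ ⟩ (y ⊕⟨ _ ⟩ z)
        ≡⟨ +-skew-assoc x y z (ratio a b 0≤a 0≤b) (ratio s c (+-nonNeg 0≤a 0≤b) 0≤c) _
                        P<1 Q<1 r≡ ⟨
      (x ⊕⟨ _ ⟩ y) ⊕⟨ _ ⟩ z  ∎
      where
      s t P Q : ℝ
      s = a + b
      t = s + c
      P = a / s
      Q = s / t
      t≢0 : t ≢ 0#
      t≢0 = a+b≢0 ∘ x+y≡0⇒x≡0 (+-nonNeg 0≤a 0≤b) 0≤c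
      b+c≢0 : b + c ≢ 0#
      b+c≢0 = b≢0 ∘ x+y≡0⇒x≡0 0≤b 0≤c
      1-1≡0 : ∀ {w} → w ≡ 1# → 1# - w ≡ 0#
      1-1≡0 w≡1 = trans (cong (λ w → 1# - w) w≡1) (-‿inverseʳ 1#)
      P<1 : P ≢ 1#
      P<1 P≡1 = x/z≢0 b≢0 a+b≢0 (trans (sym (1-x/[x+y]≡y/[x+y] a b a+b≢0)) (1-1≡0 P≡1))
      Q<1 : Q ≢ 1#
      Q<1 Q≡1 = x/z≢0 c≢0 t≢0 (trans (sym (1-x/[x+y]≡y/[x+y] s c t≢0)) (1-1≡0 Q≡1))
      PQ≡ : P * Q ≡ a / t
      PQ≡ = [x/y]*[y/z]≡x/z a t a+b≢0
      1-PQ≡ : 1# - P * Q ≡ (b + c) / t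
      1-PQ≡ = begin
        1# - P * Q                ≡⟨ cong (λ w → 1# - w) PQ≡ ⟩
        1# - a / t                ≡⟨ cong (λ w → 1# - a / w) (+-assoc a b c) ⟩
        1# - a / (a + (b + c))    ≡⟨ 1-x/[x+y]≡y/[x+y] a (b + c) (t≢0 ∘ trans (+-assoc a b c)) ⟩
        (b + c) / (a + (b + c))   ≡⟨ cong ((b + c) /_) (+-assoc a b c) ⟨
        (b + c) / t               ∎
      -- With `(1# - P) * Q` equal to `b / t` and `1# - P * Q` equal to `(b + c) / t`, the common
      -- denominator `t` cancels, leaving the inner weight of the right-nested side.
      r≡ : b / (b + c) ≡ ((1# - P) * Q) / (1# - P * Q)
      r≡ = begin
        b / (b + c)
          ≡⟨ [x*y]/y≡x (b / (b + c)) (x/z≢0 b+c≢0 t≢0) ⟨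
        b / (b + c) * ((b + c) / t) / ((b + c) / t)
          ≡⟨ cong (_/ ((b + c) / t)) ([x/y]*[y/z]≡x/z b t b+c≢0) ⟩
        (b / t) / ((b + c) / t)
          ≡⟨ cong₂ _/_ (sym [1-P]Q≡) (sym 1-PQ≡) ⟩
        ((1# - P) * Q) / (1# - P * Q)
          ∎
        where
        [1-P]Q≡ : (1# - P) * Q ≡ b / t
        [1-P]Q≡ = trans (cong (_* Q) (1-x/[x+y]≡y/[x+y] a b a+b≢0)) ([x/y]*[y/z]≡x/z b t a+b≢0)

    -- A right-nested combination can be split at any place: `ratio-assoc` moves the split past one
    -- point at a time.
    combineFrom-++ : ∀ x xs y ys →
      combineFrom _⊕⟨_⟩_ x (xs ++ y ∷ ys) ≡
      combineFrom _⊕⟨_⟩_ x xs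
        ⊕⟨ ratio (mass (x ∷ xs)) (mass (y ∷ ys)) (mass-nonNeg (x ∷ xs)) (mass-nonNeg (y ∷ ys)) ⟩
      combineFrom _⊕⟨_⟩_ y ys
    -- The mass of the single point is `val p + 0#`, whereas `share` has `val p`.
    combineFrom-++ (p , x) [] y ys =
      cong (x ⊕⟨_⟩ combineFrom _⊕⟨_⟩_ y ys)
        (val-injective (cong (λ w → w / (w + mass (y ∷ ys))) (sym (+-identityʳ (val p)))))
    combineFrom-++ (p , x) (x′ ∷ xs) y ys = begin
      x ⊕⟨ share p (x′ ∷ xs ++ y ∷ ys) ⟩ combineFrom _⊕⟨_⟩_ x′ (xs ++ y ∷ ys)
        ≡⟨ cong₂ (x ⊕⟨_⟩_)
             (val-injective (cong (λ w → val p / (val p + w)) (mass-++ (x′ ∷ xs) (y ∷ ys))))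
             (combineFrom-++ x′ xs y ys) ⟩
      x ⊕⟨ _ ⟩ (combineFrom _⊕⟨_⟩_ x′ xs ⊕⟨ _ ⟩ combineFrom _⊕⟨_⟩_ y ys)
        ≡⟨ ratio-assoc (0≤val p) (mass-nonNeg (x′ ∷ xs)) (mass-nonNeg (y ∷ ys)) x _ _ ⟩
      (x ⊕⟨ _ ⟩ combineFrom _⊕⟨_⟩_ x′ xs) ⊕⟨ _ ⟩ combineFrom _⊕⟨_⟩_ y ys
        ∎

    -- The two blocks have masses `val p` and `1# - val p`, so splitting between them gives weight
    -- `p`; inside each block the scaling then cancels.
    combine-++-scale : ∀ (us : List⁺ (𝕀 × A)) p vs → mass⁺ us ≡ 1# → mass⁺ vs ≡ 1# →
      combine _⊕⟨_⟩_ (scale p us ⁺++⁺ scale (1- p) vs) ≡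
      combine _⊕⟨_⟩_ us ⊕⟨ p ⟩ combine _⊕⟨_⟩_ vs
    combine-++-scale us@((a , x) ∷ xs) p vs@((b , y) ∷ ys) m≡1 n≡1 = begin
      combine _⊕⟨_⟩_ (scale p us ⁺++⁺ scale (1- p) vs)
        ≡⟨ combineFrom-++ (p *ᴵ a , x) us′ ((1- p) *ᴵ b , y) vs′ ⟩
      combine _⊕⟨_⟩_ (scale p us) ⊕⟨ _ ⟩ combine _⊕⟨_⟩_ (scale (1- p) vs)
        ≡⟨ cong (combine _⊕⟨_⟩_ (scale p us) ⊕⟨_⟩ combine _⊕⟨_⟩_ (scale (1- p) vs))
                (val-injective ratio≡p) ⟩
      combine _⊕⟨_⟩_ (scale p us) ⊕⟨ p ⟩ combine _⊕⟨_⟩_ (scale (1- p) vs)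
        ≡⟨ unscaled ⟩
      combine _⊕⟨_⟩_ us ⊕⟨ p ⟩ combine _⊕⟨_⟩_ vs
        ∎
      where
      us′ = map (onWeight p) xs
      vs′ = map (onWeight (1- p)) ys
      mass-us : mass⁺ (scale p us) ≡ val p
      mass-us = begin
        mass⁺ (scale p us)  ≡⟨ mass-scale p (List⁺.toList us) ⟩
        val p * mass⁺ us    ≡⟨ cong (val p *_) m≡1 ⟩
        val p * 1#          ≡⟨ *-identityʳ (val p) ⟩
        val p               ∎
      mass-vs : mass⁺ (scale (1- p) vs) ≡ 1# - val p
      mass-vs = begin
        mass⁺ (scale (1- p) vs)    ≡⟨ mass-scale (1- p) (List⁺.toList vs) ⟩
        (1# - val p) * mass⁺ vs    ≡⟨ cong ((1# - val p) *_) n≡1 ⟩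
        (1# - val p) * 1#          ≡⟨ *-identityʳ (1# - val p) ⟩
        1# - val p                 ∎
      ratio≡p : mass⁺ (scale p us) / (mass⁺ (scale p us) + mass⁺ (scale (1- p) vs)) ≡ val p
      ratio≡p = begin
        mass⁺ (scale p us) / (mass⁺ (scale p us) + mass⁺ (scale (1- p) vs))
          ≡⟨ cong₂ (λ u v → u / (u + v)) mass-us mass-vs ⟩
        val p / (val p + (1# - val p))
          ≡⟨ cong (val p /_) (x+[y-x]≡y (val p) 1#) ⟩
        val p / 1#
          -- A factor `1#` is inserted to cancel against `1# ⁻¹`.
          ≡⟨ *-identityʳ (val p / 1#) ⟨
        val p / 1# * 1#
          ≡⟨ [x/y]*y≡x (val p) (0≢1 ∘ sym) ⟩
        val p
          ∎
      unscaled : combine _⊕⟨_⟩_ (scale p us) ⊕⟨ p ⟩ combine _⊕⟨_⟩_ (scale (1- p) vs) ≡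
                 combine _⊕⟨_⟩_ us ⊕⟨ p ⟩ combine _⊕⟨_⟩_ vs
      -- A block scaled by 0 cannot be unscaled, but it has weight 0 in the outer combination and is
      -- dropped on both sides.
      unscaled with val p ≟ 0# | val (1- p) ≟ 0#
      ... | yes p≡0 | yes 1-p≡0 = ⊥-elim (0≢1 (trans (sym p≡0) (1-x≡0⇒x≡1 1-p≡0)))
      ... | yes p≡0 | no 1-p≢0  = begin
        combine _⊕⟨_⟩_ (scale p us) ⊕⟨ p ⟩ combine _⊕⟨_⟩_ (scale (1- p) vs)
          ≡⟨ ⊕-zero _ _ p≡0 ⟩
        combine _⊕⟨_⟩_ (scale (1- p) vs)
          ≡⟨ combineFrom-scale (1- p) 1-p≢0 b y ys ⟩
        combine _⊕⟨_⟩_ vs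
          ≡⟨ ⊕-zero _ _ p≡0 ⟨
        combine _⊕⟨_⟩_ us ⊕⟨ p ⟩ combine _⊕⟨_⟩_ vs
          ∎
      ... | no p≢0 | yes 1-p≡0 = begin
        combine _⊕⟨_⟩_ (scale p us) ⊕⟨ p ⟩ combine _⊕⟨_⟩_ (scale (1- p) vs)
          ≡⟨ ⊕-one _ _ (1-x≡0⇒x≡1 1-p≡0) ⟩
        combine _⊕⟨_⟩_ (scale p us)
          ≡⟨ combineFrom-scale p p≢0 a x xs ⟩
        combine _⊕⟨_⟩_ us
          ≡⟨ ⊕-one _ _ (1-x≡0⇒x≡1 1-p≡0) ⟨
        combine _⊕⟨_⟩_ us ⊕⟨ p ⟩ combine _⊕⟨_⟩_ vs
          ∎
      ... | no p≢0 | no 1-p≢0 =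
        cong₂ (_⊕⟨ p ⟩_) (combineFrom-scale p p≢0 a x xs) (combineFrom-scale (1- p) 1-p≢0 b y ys)

    ∑-mix : {B : Set} (f : B → A) (μ : Dist B) (p : 𝕀) (ν : Dist B) →
            ∑ _⊕⟨_⟩_ (mix μ p ν) f ≡ ∑ _⊕⟨_⟩_ μ f ⊕⟨ p ⟩ ∑ _⊕⟨_⟩_ ν f
    ∑-mix f μ@(mkDist ((a , x) ∷ xs) _) p ν@(mkDist ((b , y) ∷ ys) _) = begin
      ∑ _⊕⟨_⟩_ (mix μ p ν) f
        ≡⟨ cong (combineFrom _⊕⟨_⟩_ (p *ᴵ a , f x))
             (trans (map-++ (onPoint f) (map (onWeight p) xs)
                           (List⁺.toList (scale (1- p) (points ν))))
                    (cong₂ (λ us vs → us ++ ((1- p) *ᴵ b , f y) ∷ vs)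
                           (map-scale f p xs) (map-scale f (1- p) ys))) ⟩
      combine _⊕⟨_⟩_ (scale p (List⁺.map (onPoint f) (points μ)) ⁺++⁺
                      scale (1- p) (List⁺.map (onPoint f) (points ν)))
        ≡⟨ combine-++-scale (List⁺.map (onPoint f) (points μ)) p (List⁺.map (onPoint f) (points ν))
             (trans (mass-map f (List⁺.toList (points μ))) (mass⁺≡1 μ))
             (trans (mass-map f (List⁺.toList (points ν))) (mass⁺≡1 ν)) ⟩
      ∑ _⊕⟨_⟩_ μ f ⊕⟨ p ⟩ ∑ _⊕⟨_⟩_ ν f
        ∎

-- Least maximal strategies and their components.

module Optimality {ℜ : Reals} {Sg : Signature ℜ} {ℛ : Rewards ℜ} (I : Interpretation Sg ℛ) where
  open Reals ℜ using (0#; 1#)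
  open RealProperties ℜ using (_≟_)
  open Field ℜ using (1-x≡0⇒x≡1; 1-x≡1⇒x≡0)
  open Convexity ℜ
  open Barycentric ℜ
  open Rewards ℛ
  open IsCommutativeMonoid isCommutativeMonoid using () renaming (comm to +ᴿ-comm)
  open Interpretation I
  open Language Sg hiding (val)
  open Selection I
  open Equivalence using (to; from)
  open ≡-Reasoning

  Before-asym : ∀ {σ} (E : EffVal σ) {s t} → Before E s t → Before E t s → ⊥
  Before-asym (E or F)     {inj₁ s} {inj₁ t} s<t t<s = Before-asym E s<t t<s
  Before-asym (E or F)     {inj₂ s} {inj₂ t} s<t t<s = Before-asym F s<t t<s
  Before-asym (c · E)      s<t t<s = Before-asym E s<t t<s
  Before-asym (E +⟨ p ⟩ F) (inj₁ s<t)        (inj₁ t<s)        = Before-asym E s<t t<s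
  -- Equal first components make `s<t` compare a strategy with itself, which asymmetry refutes.
  Before-asym (E +⟨ p ⟩ F) (inj₁ s<t)        (inj₂ (refl , _)) = Before-asym E s<t s<t
  Before-asym (E +⟨ p ⟩ F) (inj₂ (refl , _)) (inj₁ t<s)        = Before-asym E t<s t<s
  Before-asym (E +⟨ p ⟩ F) (inj₂ (_ , s<t))  (inj₂ (_ , t<s))  = Before-asym F s<t t<s

  -- Of two such strategies each equals or precedes the other. Optimal strategies can thus be
  -- identified by their defining property, without unfolding `leastMaximal`.
  LeastMaximal-unique : ∀ {σ} (E : EffVal σ) {f s t} →
    LeastMaximal E f s → LeastMaximal E f t → s ≡ t
  LeastMaximal-unique E (maxˢ , leastˢ) (maxᵗ , leastᵗ) with leastˢ _ maxᵗ | leastᵗ _ maxˢ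
  ... | inj₁ s≡t | _        = s≡t
  ... | inj₂ _   | inj₁ t≡s = sym t≡s
  ... | inj₂ s<t | inj₂ t<s = ⊥-elim (Before-asym E s<t t<s)

  -- Optimality depends only on how the rewards compare, not on their values.
  LeastMaximal-resp : ∀ {σ} (E : EffVal σ) {f g : Str E → R} →
    (∀ s t → f s ≤ᴿ f t ⇔ g s ≤ᴿ g t) → ∀ {s} → LeastMaximal E f s → LeastMaximal E g s
  LeastMaximal-resp E f⇔g (max , least) =
    (λ t → f⇔g _ _ .to (max t)) , λ t maxᵗ → least t (λ u → f⇔g _ _ .from (maxᵗ u))

  s-opt-least : ∀ {σ} (E : EffVal σ) → LeastMaximal E (Rew E) (s-opt E)
  s-opt-least E = proj₂ (leastMaximal E (Rew E))

  Rew-· : ∀ {σ} c (E : EffVal σ) s → Rew (c · E) s ≡ ⟦ c ⟧ᶜ +ᴿ Rew E s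
  Rew-· c E s = trans (∑-mapᴰ _ (Out E s) proj₁)
                      (sym (∑-hom (⟦ c ⟧ᶜ +ᴿ_) (λ p r r′ → +ᴿ-distribˡ _ r p r′) (Out E s) proj₁))

  Rew-+ : ∀ {σ} (E F : EffVal σ) p s t → Rew (E +⟨ p ⟩ F) (s , t) ≡ Rew E s +⟨ p ⟩ᴿ Rew F t
  Rew-+ E F p s t = ∑-mix isBarycentric proj₁ (Out E s) p (Out F t)

  -- `c · E` has the strategies of `E` in the same order, and by `≤ᴿ-+` adding `⟦ c ⟧ᶜ` to all
  -- rewards preserves and reflects their order.
  s-opt-· : ∀ {σ} c (E : EffVal σ) → s-opt (c · E) ≡ s-opt E
  s-opt-· c E = sym (LeastMaximal-unique (c · E) {Rew (c · E)}
    (LeastMaximal-resp E shift (s-opt-least E)) (s-opt-least (c · E)))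
    where
    shift : ∀ s t → Rew E s ≤ᴿ Rew E t ⇔ Rew (c · E) s ≤ᴿ Rew (c · E) t
    shift s t = subst₂ (λ r r′ → Rew E s ≤ᴿ Rew E t ⇔ r ≤ᴿ r′)
      (trans (+ᴿ-comm (Rew E s) ⟦ c ⟧ᶜ) (sym (Rew-· c E s)))
      (trans (+ᴿ-comm (Rew E t) ⟦ c ⟧ᶜ) (sym (Rew-· c E t)))
      (≤ᴿ-+ (Rew E s) (Rew E t) ⟦ c ⟧ᶜ)

  -- `leastMaximal` decides by this very test, so both sides compute once its outcome is known.
  Out-or : ∀ {σ} (E F : EffVal σ) → Out (E or F) (s-opt (E or F)) ≡
    (if does (Rew F (s-opt F) ≤ᴿ? Rew E (s-opt E)) then Out E (s-opt E) else Out F (s-opt F))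
  Out-or E F with Rew F (s-opt F) ≤ᴿ? Rew E (s-opt E)
  ... | yes _ = refl
  ... | no  _ = refl

  module _ {σ} (E F : EffVal σ) (p : 𝕀) {f : Str E → R} {g : Str F → R} {h : Str E × Str F → R}
           (h≡ : ∀ s t → h (s , t) ≡ f s +⟨ p ⟩ᴿ g t) where

    -- For such `p` the reward of a pair is strictly monotone in each component, so a pair is
    -- maximal exactly when both components are; the lexicographic order then makes the pair of
    -- least ones least.
    LeastMaximal-+ : 0< p → p <1 → ∀ {a b} → LeastMaximal E f a → LeastMaximal F g b →
                     LeastMaximal (E +⟨ p ⟩ F) h (a , b)
    LeastMaximal-+ 0<p p<1 {a} {b} (maxᵃ , leastᵃ) (maxᵇ , leastᵇ) = max , least
      where
      0<1-p : 0< (1- p)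
      0<1-p = p<1 ∘ 1-x≡0⇒x≡1
      1-p<1 : (1- p) <1
      1-p<1 = 0<p ∘ 1-x≡1⇒x≡0
      -- `≤ᴿ-+⟨⟩` varies the first argument of a mixture; skewing brings the second one there.
      h≡-skew : ∀ s t → h (s , t) ≡ g t +⟨ 1- p ⟩ᴿ f s
      h≡-skew s t = trans (h≡ s t) (IsBarycentric.+-skew isBarycentric (f s) (g t) p)
      monoˡ : ∀ s s′ t → f s ≤ᴿ f s′ ⇔ h (s , t) ≤ᴿ h (s′ , t)
      monoˡ s s′ t = subst₂ (λ r r′ → f s ≤ᴿ f s′ ⇔ r ≤ᴿ r′)
        (sym (h≡ s t)) (sym (h≡ s′ t)) (≤ᴿ-+⟨⟩ (f s) (f s′) (g t) p 0<p p<1)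
      monoʳ : ∀ s t t′ → g t ≤ᴿ g t′ ⇔ h (s , t) ≤ᴿ h (s , t′)
      monoʳ s t t′ = subst₂ (λ r r′ → g t ≤ᴿ g t′ ⇔ r ≤ᴿ r′)
        (sym (h≡-skew s t)) (sym (h≡-skew s t′)) (≤ᴿ-+⟨⟩ (g t) (g t′) (f s) (1- p) 0<1-p 1-p<1)
      max : Maximal (E +⟨ p ⟩ F) h (a , b)
      max (s , t) = ≤ᴿ-trans (monoˡ s a t .to (maxᵃ s)) (monoʳ a t b .to (maxᵇ t))
      least : ∀ st → Maximal (E +⟨ p ⟩ F) h st →
              (a , b) ≡ st ⊎ Before (E +⟨ p ⟩ F) (a , b) st
      least (s , t) m
        with leastᵃ s (λ s′ → monoˡ s′ s t .from (m (s′ , t)))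
           | leastᵇ t (λ t′ → monoʳ s t′ t .from (m (s , t′)))
      ... | inj₂ a<s | _        = inj₂ (inj₁ a<s)
      ... | inj₁ a≡s | inj₂ b<t = inj₂ (inj₂ (a≡s , b<t))
      ... | inj₁ a≡s | inj₁ b≡t = inj₁ (cong₂ _,_ a≡s b≡t)

    LeastMaximal-+₁ : val p ≡ 1# → ∀ {a b} →
                      LeastMaximal (E +⟨ p ⟩ F) h (a , b) → LeastMaximal E f a
    LeastMaximal-+₁ p≡1 {a} {b} (maxᵃᵇ , leastᵃᵇ) = max , least
      where
      h≡f : ∀ s t → h (s , t) ≡ f s
      h≡f s t = trans (h≡ s t) (⊕-one isBarycentric (f s) (g t) p≡1)
      max : Maximal E f a
      max s = subst₂ _≤ᴿ_ (h≡f s b) (h≡f a b) (maxᵃᵇ (s , b))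
      least : ∀ s → Maximal E f s → a ≡ s ⊎ Before E a s
      -- The reward ignores the second component, so any competitor `s` may be completed by `b`
      -- itself.
      least s m with leastᵃᵇ (s , b)
                          (λ (s′ , t) → subst₂ _≤ᴿ_ (sym (h≡f s′ t)) (sym (h≡f s b)) (m s′))
      ... | inj₁ ab≡sb            = inj₁ (cong proj₁ ab≡sb)
      ... | inj₂ (inj₁ a<s)       = inj₂ a<s
      ... | inj₂ (inj₂ (a≡s , _)) = inj₁ a≡s

    LeastMaximal-+₀ : val p ≡ 0# → ∀ {a b} →
                      LeastMaximal (E +⟨ p ⟩ F) h (a , b) → LeastMaximal F g b
    LeastMaximal-+₀ p≡0 {a} {b} (maxᵃᵇ , leastᵃᵇ) = max , least
      where
      h≡g : ∀ s t → h (s , t) ≡ g t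
      h≡g s t = trans (h≡ s t) (⊕-zero isBarycentric (f s) (g t) p≡0)
      max : Maximal F g b
      max t = subst₂ _≤ᴿ_ (h≡g a t) (h≡g a b) (maxᵃᵇ (a , t))
      least : ∀ t → Maximal F g t → b ≡ t ⊎ Before F b t
      least t m with leastᵃᵇ (a , t)
                          (λ (s , t′) → subst₂ _≤ᴿ_ (sym (h≡g s t′)) (sym (h≡g a t)) (m t′))
      ... | inj₁ ab≡at            = inj₁ (cong proj₂ ab≡at)
      -- The competitor has the same first component, so the lexicographic order must decide on the
      -- second.
      ... | inj₂ (inj₁ a<a)       = ⊥-elim (Before-asym E a<a a<a)
      ... | inj₂ (inj₂ (_ , b<t)) = inj₂ b<t

  -- When p is 0 or 1, one component of the least maximal strategy is merely the least
  -- strategy, but then it does not contribute to the combination either.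
  ∑-Out-+ : ∀ {σ} {A : Set} {_⊕⟨_⟩_ : A → 𝕀 → A → A} → IsBarycentric _⊕⟨_⟩_ →
    ∀ (E F : EffVal σ) p (φ : R × Val σ → A) {a b s t} →
    LeastMaximal (E +⟨ p ⟩ F) (Rew (E +⟨ p ⟩ F)) (a , b) →
    LeastMaximal E (Rew E) s → LeastMaximal F (Rew F) t →
    ∑ _⊕⟨_⟩_ (Out (E +⟨ p ⟩ F) (a , b)) φ ≡ ∑ _⊕⟨_⟩_ (Out E s) φ ⊕⟨ p ⟩ ∑ _⊕⟨_⟩_ (Out F t) φ
  ∑-Out-+ {_⊕⟨_⟩_ = _⊕⟨_⟩_} isBary E F p φ {a} {b} {s} {t} lᵃᵇ lˢ lᵗ =
    trans (∑-mix isBary φ (Out E a) p (Out F b)) optimal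
    where
    x : Str E → _
    x s = ∑ _⊕⟨_⟩_ (Out E s) φ
    y : Str F → _
    y t = ∑ _⊕⟨_⟩_ (Out F t) φ
    Rew≡ = Rew-+ E F p
    optimal : x a ⊕⟨ p ⟩ y b ≡ x s ⊕⟨ p ⟩ y t
    optimal with val p ≟ 0# | val p ≟ 1#
    ... | yes p≡0 | _ = begin
      x a ⊕⟨ p ⟩ y b  ≡⟨ ⊕-zero isBary (x a) (y b) p≡0 ⟩
      y b             ≡⟨ cong y (LeastMaximal-unique F (LeastMaximal-+₀ E F p Rew≡ p≡0 lᵃᵇ) lᵗ) ⟩
      y t             ≡⟨ ⊕-zero isBary (x s) (y t) p≡0 ⟨
      x s ⊕⟨ p ⟩ y t  ∎
    ... | no _ | yes p≡1 = begin
      x a ⊕⟨ p ⟩ y b  ≡⟨ ⊕-one isBary (x a) (y b) p≡1 ⟩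
      x a             ≡⟨ cong x (LeastMaximal-unique E (LeastMaximal-+₁ E F p Rew≡ p≡1 lᵃᵇ) lˢ) ⟩
      x s             ≡⟨ ⊕-one isBary (x s) (y t) p≡1 ⟨
      x s ⊕⟨ p ⟩ y t  ∎
    ... | no p≢0 | no p≢1 =
      cong (λ (s , t) → x s ⊕⟨ p ⟩ y t)
        (LeastMaximal-unique (E +⟨ p ⟩ F) lᵃᵇ (LeastMaximal-+ E F p Rew≡ p≢0 p≢1 lˢ lᵗ))

-- Kleisli extension of `S` as a homomorphism for the effects.

module Adequacy (ext : Extensionality 0ℓ 0ℓ) {ℜ : Reals} {Sg : Signature ℜ} {ℛ : Rewards ℜ}
                (I : Interpretation Sg ℛ) (𝕋 : AuxMonad ℛ) where
  open Convexity ℜ using (𝕀; ∑)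
  open Barycentric ℜ using (∑-hom; ∑-cong; ∑-mapᴰ)
  open Signature Sg
  open Rewards ℛ
  open IsCommutativeMonoid isCommutativeMonoid using () renaming (identityʳ to +ᴿ-identityʳ)
  open Interpretation I
  open Language Sg
  open Fusion Sg using (cong₃)
  open Selection I
  open Optimality I
  open AuxMonad 𝕋
  open Denotation I 𝕋
  open ≡-Reasoning

  private variable
    X Y Z : Set
    Γ Δ : Ctx
    σ τ : Type
    bs : List Bas

  -- Since `α` is a `T`-algebra, inner computations may be replaced by their rewards before the
  -- outer one is evaluated. This yields the equation between `𝐑 (f †ˢ F) γ` and `𝐑 F γ′`.
  α-mapᵀ-† : (f : X → T Y) (γ : Y → R) (u : T X) →
             α (mapᵀ γ ((f †) u)) ≡ α (mapᵀ (λ x → α (mapᵀ γ (f x))) u)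
  α-mapᵀ-† f γ u = begin
    α (mapᵀ γ ((f †) u))           ≡⟨ cong α (†-† (η ∘ γ) f u) ⟩
    -- The unit law splits `g` into `id †` after `η ∘ g`, exposing the double layer of `T` to which
    -- `α-μ` applies.
    α ((g †) u)                    ≡⟨ cong (λ h → α ((h †) u)) (ext λ x → †-η id (g x)) ⟨
    α (((id † ∘ η ∘ g) †) u)       ≡⟨ cong α (†-† id (η ∘ g) u) ⟨
    α ((id †) (mapᵀ g u))          ≡⟨ α-μ (mapᵀ g u) ⟩
    α (mapᵀ α (mapᵀ g u))          ≡⟨ cong α (†-† (η ∘ α) (η ∘ g) u) ⟩
    α (((mapᵀ α ∘ η ∘ g) †) u)     ≡⟨ cong (λ h → α ((h †) u)) (ext λ x → †-η (η ∘ α) (g x)) ⟩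
    α (mapᵀ (α ∘ g) u)             ∎
    where
    g = mapᵀ γ ∘ f

  †ˢ-ηˢ : (f : X → S Y) (x : X) → (f †ˢ) (ηˢ x) ≡ f x
  †ˢ-ηˢ f x = ext λ γ → †-η (λ y → f y γ) x

  †ˢ-return : (f : X → S Y) {F : S X} {x : X} → F ≡ ηˢ x → (f †ˢ) F ≡ f x
  †ˢ-return f {x = x} F≡ = trans (cong (f †ˢ) F≡) (†ˢ-ηˢ f x)

  -- This property is closed under composition, so evaluation contexts can be handled one layer at a
  -- time.
  record IsHom (h : S X → S Y) : Set where
    field
      hom-or : ∀ F G → h (F orˢ G) ≡ h F orˢ h G
      hom-·  : ∀ r F → h (r ·ˢ F) ≡ r ·ˢ h F
      hom-+  : ∀ F p G → h (F +⟨ p ⟩ˢ G) ≡ h F +⟨ p ⟩ˢ h G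

  open IsHom

  id-hom : IsHom {X} id
  id-hom = record { hom-or = λ _ _ → refl ; hom-· = λ _ _ → refl ; hom-+ = λ _ _ _ → refl }

  ∘-hom : {h : S Y → S Z} {k : S X → S Y} → IsHom h → IsHom k → IsHom (h ∘ k)
  ∘-hom {h = h} hʰ kʰ = record
    { hom-or = λ F G → trans (cong h (hom-or kʰ F G)) (hom-or hʰ _ _)
    ; hom-·  = λ r F → trans (cong h (hom-· kʰ r F)) (hom-· hʰ r _)
    ; hom-+  = λ F p G → trans (cong h (hom-+ kʰ F p G)) (hom-+ hʰ _ p _)
    }

  †ˢ-hom : (f : X → S Y) → IsHom (f †ˢ)
  †ˢ-hom f = record
    { hom-or = λ F G → ext (or-case F G)
    ; hom-·  = λ r F → ext λ γ → ·-algebraic (λ x → f x γ) r _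
    ; hom-+  = λ F p G → ext λ γ → +-algebraic (λ x → f x γ) p _ _
    }
    where
    or-case : ∀ F G γ → (f †ˢ) (F orˢ G) γ ≡ ((f †ˢ) F orˢ (f †ˢ) G) γ
    or-case F G γ = begin
      (f †ˢ) (F orˢ G) γ
        ≡⟨ if-float ((λ x → f x γ) †) (does (𝐑 G γ′ ≤ᴿ? 𝐑 F γ′)) ⟩
      (if does (𝐑 G γ′ ≤ᴿ? 𝐑 F γ′) then (f †ˢ) F γ else (f †ˢ) G γ)
        -- Both branches are already extended alike, since `γ′` depends on `f` and `γ` only; what is
        -- left is that the two tests compare the same rewards.
        ≡⟨ cong₂ (λ r s → if does (r ≤ᴿ? s) then (f †ˢ) F γ else (f †ˢ) G γ)
                 (α-mapᵀ-† _ γ (G γ′)) (α-mapᵀ-† _ γ (F γ′)) ⟨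
      ((f †ˢ) F orˢ (f †ˢ) G) γ
        ∎
      where
      γ′ = λ x → 𝐑 (f x) γ

  -- The continuations in the defining clauses of 𝒮⟦_⟧ and 𝒮⟦_⟧ᵃ.
  applyᴷ : ∀ {b} → Fun bs b → All ⟦_⟧ᵇ bs → S ⟦ b ⟧ᵇ
  applyᴷ f as = ηˢ (⟦ f ⟧ᶠ as)

  branchᴷ : S X → S X → Bool → S X
  branchᴷ F G b = if b then F else G

  pairʳᴷ : X → Y → S (X × Y)
  pairʳᴷ a b = ηˢ (a , b)

  pairᴷ : S Y → X → S (X × Y)
  pairᴷ F a = (pairʳᴷ a †ˢ) F

  callᴷ : S X → (X → S Y) → S Y
  callᴷ F g = (g †ˢ) F

  consʳᴷ : ∀ {b} → ⟦ b ⟧ᵇ → All ⟦_⟧ᵇ bs → S (All ⟦_⟧ᵇ (b ∷ bs))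
  consʳᴷ a as = ηˢ (a ∷ as)

  consᴷ : ∀ {b} → S (All ⟦_⟧ᵇ bs) → ⟦ b ⟧ᵇ → S (All ⟦_⟧ᵇ (b ∷ bs))
  consᴷ F a = (consʳᴷ a †ˢ) F

  bodyᴷ : Term (σ ∷ []) τ → 𝒮⟦ σ ⟧ᵗ → S 𝒮⟦ τ ⟧ᵗ
  bodyᴷ M a = 𝒮⟦ M ⟧ (a ∷ [])

  -- Semantics of renaming and substitution.

  mutual
    𝒮-ren : (ρ : Ren Γ Δ) (γ : Env Γ) (δ : Env Δ) →
            (∀ {σ} (x : σ ∈ Γ) → All.lookup δ (ρ x) ≡ All.lookup γ x) →
            (M : Term Γ σ) → 𝒮⟦ ren ρ M ⟧ δ ≡ 𝒮⟦ M ⟧ γ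
    𝒮-ren ρ γ δ h (var x)      = cong ηˢ (h x)
    𝒮-ren ρ γ δ h (con c)      = refl
    𝒮-ren ρ γ δ h (fun f Ms)   = cong (applyᴷ f †ˢ) (𝒮-renArgs ρ γ δ h Ms)
    𝒮-ren ρ γ δ h (cond L M N) = cong₃ (λ l m n → (branchᴷ m n †ˢ) l)
                                       (𝒮-ren ρ γ δ h L) (𝒮-ren ρ γ δ h M) (𝒮-ren ρ γ δ h N)
    𝒮-ren ρ γ δ h (M or N)     = cong₂ _orˢ_ (𝒮-ren ρ γ δ h M) (𝒮-ren ρ γ δ h N)
    𝒮-ren ρ γ δ h (N · M)      = cong₂ (λ n m → ((_·ˢ m) †ˢ) n)
                                       (𝒮-ren ρ γ δ h N) (𝒮-ren ρ γ δ h M)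
    𝒮-ren ρ γ δ h (M +⟨ p ⟩ N) = cong₂ (_+⟨ p ⟩ˢ_) (𝒮-ren ρ γ δ h M) (𝒮-ren ρ γ δ h N)
    𝒮-ren ρ γ δ h ⋆            = refl
    𝒮-ren ρ γ δ h ⟨ M , N ⟩    = cong₂ (λ m n → (pairᴷ n †ˢ) m)
                                       (𝒮-ren ρ γ δ h M) (𝒮-ren ρ γ δ h N)
    𝒮-ren ρ γ δ h (fst M)      = cong ((ηˢ ∘ proj₁) †ˢ) (𝒮-ren ρ γ δ h M)
    𝒮-ren ρ γ δ h (snd M)      = cong ((ηˢ ∘ proj₂) †ˢ) (𝒮-ren ρ γ δ h M)
    𝒮-ren ρ γ δ h (lam M)      = cong ηˢ (ext λ a →
      𝒮-ren (extᴿ ρ) (a ∷ γ) (a ∷ δ)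
        (λ where (here refl) → refl
                 (there x)   → h x) M)
    𝒮-ren ρ γ δ h (app M N)    = cong₂ (λ m n → (callᴷ n †ˢ) m)
                                       (𝒮-ren ρ γ δ h M) (𝒮-ren ρ γ δ h N)

    𝒮-renArgs : (ρ : Ren Γ Δ) (γ : Env Γ) (δ : Env Δ) →
                (∀ {σ} (x : σ ∈ Γ) → All.lookup δ (ρ x) ≡ All.lookup γ x) →
                (Ms : Args Γ bs) → 𝒮⟦ renArgs ρ Ms ⟧ᵃ δ ≡ 𝒮⟦ Ms ⟧ᵃ γ
    𝒮-renArgs ρ γ δ h []       = refl
    𝒮-renArgs ρ γ δ h (M ∷ Ms) = cong₂ (λ m ms → (consᴷ ms †ˢ) m)
                                       (𝒮-ren ρ γ δ h M) (𝒮-renArgs ρ γ δ h Ms)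

  mutual
    -- Environments hold pure elements, so the terms substituted must denote pure computations; for
    -- values this is `𝒮-⌜⌝`.
    𝒮-sub : (θ : Sub Γ Δ) (γ : Env Γ) (δ : Env Δ) →
            (∀ {σ} (x : σ ∈ Γ) → 𝒮⟦ θ x ⟧ δ ≡ ηˢ (All.lookup γ x)) →
            (M : Term Γ σ) → 𝒮⟦ sub θ M ⟧ δ ≡ 𝒮⟦ M ⟧ γ
    𝒮-sub θ γ δ h (var x)      = h x
    𝒮-sub θ γ δ h (con c)      = refl
    𝒮-sub θ γ δ h (fun f Ms)   = cong (applyᴷ f †ˢ) (𝒮-subArgs θ γ δ h Ms)
    𝒮-sub θ γ δ h (cond L M N) = cong₃ (λ l m n → (branchᴷ m n †ˢ) l)
                                       (𝒮-sub θ γ δ h L) (𝒮-sub θ γ δ h M) (𝒮-sub θ γ δ h N)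
    𝒮-sub θ γ δ h (M or N)     = cong₂ _orˢ_ (𝒮-sub θ γ δ h M) (𝒮-sub θ γ δ h N)
    𝒮-sub θ γ δ h (N · M)      = cong₂ (λ n m → ((_·ˢ m) †ˢ) n)
                                       (𝒮-sub θ γ δ h N) (𝒮-sub θ γ δ h M)
    𝒮-sub θ γ δ h (M +⟨ p ⟩ N) = cong₂ (_+⟨ p ⟩ˢ_) (𝒮-sub θ γ δ h M) (𝒮-sub θ γ δ h N)
    𝒮-sub θ γ δ h ⋆            = refl
    𝒮-sub θ γ δ h ⟨ M , N ⟩    = cong₂ (λ m n → (pairᴷ n †ˢ) m)
                                       (𝒮-sub θ γ δ h M) (𝒮-sub θ γ δ h N)
    𝒮-sub θ γ δ h (fst M)      = cong ((ηˢ ∘ proj₁) †ˢ) (𝒮-sub θ γ δ h M)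
    𝒮-sub θ γ δ h (snd M)      = cong ((ηˢ ∘ proj₂) †ˢ) (𝒮-sub θ γ δ h M)
    𝒮-sub θ γ δ h (lam M)      = cong ηˢ (ext λ a →
      𝒮-sub (extˢ θ) (a ∷ γ) (a ∷ δ)
        (λ where (here refl) → refl
                 -- Weakening `θ x` under the binder leaves its denotation unchanged.
                 (there x)   → trans (𝒮-ren there δ (a ∷ δ) (λ _ → refl) (θ x)) (h x)) M)
    𝒮-sub θ γ δ h (app M N)    = cong₂ (λ m n → (callᴷ n †ˢ) m)
                                       (𝒮-sub θ γ δ h M) (𝒮-sub θ γ δ h N)

    𝒮-subArgs : (θ : Sub Γ Δ) (γ : Env Γ) (δ : Env Δ) →
                (∀ {σ} (x : σ ∈ Γ) → 𝒮⟦ θ x ⟧ δ ≡ ηˢ (All.lookup γ x)) →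
                (Ms : Args Γ bs) → 𝒮⟦ subArgs θ Ms ⟧ᵃ δ ≡ 𝒮⟦ Ms ⟧ᵃ γ
    𝒮-subArgs θ γ δ h []       = refl
    𝒮-subArgs θ γ δ h (M ∷ Ms) = cong₂ (λ m ms → (consᴷ ms †ˢ) m)
                                       (𝒮-sub θ γ δ h M) (𝒮-subArgs θ γ δ h Ms)

  -- Soundness of values and of reduction steps.

  𝒮-⌜⌝ : (V : Val σ) → 𝒮⟦ ⌜ V ⌝ ⟧₀ ≡ ηˢ 𝒮ₚ⟦ V ⟧
  𝒮-⌜⌝ (con c)   = refl
  𝒮-⌜⌝ ⋆         = refl
  𝒮-⌜⌝ ⟨ V , W ⟩ = trans (†ˢ-return (pairᴷ 𝒮⟦ ⌜ W ⌝ ⟧₀) (𝒮-⌜⌝ V))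
                         (†ˢ-return (pairʳᴷ 𝒮ₚ⟦ V ⟧) (𝒮-⌜⌝ W))
  𝒮-⌜⌝ (lam M)   = refl

  𝒮-[] : (M : Term (σ ∷ []) τ) (V : Val σ) → 𝒮⟦ M [ ⌜ V ⌝ ] ⟧₀ ≡ 𝒮⟦ M ⟧ (𝒮ₚ⟦ V ⟧ ∷ [])
  𝒮-[] M V = 𝒮-sub (var ,ˢ ⌜ V ⌝) (𝒮ₚ⟦ V ⟧ ∷ []) [] (λ where (here refl) → 𝒮-⌜⌝ V) M

  𝒮-constants : (cs : All Const bs) → 𝒮⟦ All.map con cs ⟧ᵃ [] ≡ ηˢ (All.map ⟦_⟧ᶜ cs)
  𝒮-constants []       = refl
  𝒮-constants (c ∷ cs) = trans (†ˢ-ηˢ (consᴷ (𝒮⟦ All.map con cs ⟧ᵃ [])) ⟦ c ⟧ᶜ)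
                               (†ˢ-return (consʳᴷ ⟦ c ⟧ᶜ) (𝒮-constants cs))

  -- The evaluated parts of a redex denote pure computations, so the unit law removes the Kleisli
  -- extensions.
  ⟶ᵣ-sound : {Q Q′ : Program σ} → Q ⟶ᵣ Q′ → 𝒮⟦ Q ⟧₀ ≡ 𝒮⟦ Q′ ⟧₀
  ⟶ᵣ-sound (δ-fun f cs) = trans (†ˢ-return (applyᴷ f) (𝒮-constants cs)) (cong ηˢ (⟦val⟧ f cs))
  ⟶ᵣ-sound (if-tt {M = M} {N}) = †ˢ-return (branchᴷ 𝒮⟦ M ⟧₀ 𝒮⟦ N ⟧₀) (cong ηˢ ⟦tt⟧)
  ⟶ᵣ-sound (if-ff {M = M} {N}) = †ˢ-return (branchᴷ 𝒮⟦ M ⟧₀ 𝒮⟦ N ⟧₀) (cong ηˢ ⟦ff⟧)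
  ⟶ᵣ-sound (fst-β V W) = trans (†ˢ-return (ηˢ ∘ proj₁) (𝒮-⌜⌝ ⟨ V , W ⟩)) (sym (𝒮-⌜⌝ V))
  ⟶ᵣ-sound (snd-β V W) = trans (†ˢ-return (ηˢ ∘ proj₂) (𝒮-⌜⌝ ⟨ V , W ⟩)) (sym (𝒮-⌜⌝ W))
  ⟶ᵣ-sound (app-β M V) = begin
    (callᴷ 𝒮⟦ ⌜ V ⌝ ⟧₀ †ˢ) (ηˢ (bodyᴷ M))  ≡⟨ †ˢ-ηˢ (callᴷ 𝒮⟦ ⌜ V ⌝ ⟧₀) (bodyᴷ M) ⟩
    (bodyᴷ M †ˢ) 𝒮⟦ ⌜ V ⌝ ⟧₀               ≡⟨ †ˢ-return (bodyᴷ M) (𝒮-⌜⌝ V) ⟩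
    𝒮⟦ M ⟧ (𝒮ₚ⟦ V ⟧ ∷ [])                  ≡⟨ 𝒮-[] M V ⟨
    𝒮⟦ M [ ⌜ V ⌝ ] ⟧₀                      ∎

  -- Evaluation contexts as homomorphisms.

  ⟦_⟧ᶜᵃ : ∀ {b} → ArgsCxt bs b → S ⟦ b ⟧ᵇ → S (All ⟦_⟧ᵇ bs)
  ⟦ hole Ms ⟧ᶜᵃ = consᴷ (𝒮⟦ Ms ⟧ᵃ []) †ˢ
  ⟦ c ∷ A ⟧ᶜᵃ   = consʳᴷ ⟦ c ⟧ᶜ †ˢ ∘ ⟦ A ⟧ᶜᵃ

  -- Values to the left of the hole are already passed to the continuation. The hole is then always
  -- the argument of an extension, so a context is a composite of maps `f †ˢ` and hence a
  -- homomorphism.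
  ⟦_⟧ᶜˣ : EvCxt σ τ → S 𝒮⟦ σ ⟧ᵗ → S 𝒮⟦ τ ⟧ᵗ
  ⟦ □ ⟧ᶜˣ          = id
  ⟦ fun f A 𝓔 ⟧ᶜˣ  = applyᴷ f †ˢ ∘ ⟦ A ⟧ᶜᵃ ∘ ⟦ 𝓔 ⟧ᶜˣ
  ⟦ cond 𝓔 M N ⟧ᶜˣ = branchᴷ 𝒮⟦ M ⟧₀ 𝒮⟦ N ⟧₀ †ˢ ∘ ⟦ 𝓔 ⟧ᶜˣ
  ⟦ 𝓔 · M ⟧ᶜˣ      = (_·ˢ 𝒮⟦ M ⟧₀) †ˢ ∘ ⟦ 𝓔 ⟧ᶜˣ
  ⟦ ⟨ 𝓔 , N ⟩ˡ ⟧ᶜˣ = pairᴷ 𝒮⟦ N ⟧₀ †ˢ ∘ ⟦ 𝓔 ⟧ᶜˣ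
  ⟦ ⟨ V , 𝓔 ⟩ʳ ⟧ᶜˣ = pairʳᴷ 𝒮ₚ⟦ V ⟧ †ˢ ∘ ⟦ 𝓔 ⟧ᶜˣ
  ⟦ fst 𝓔 ⟧ᶜˣ      = (ηˢ ∘ proj₁) †ˢ ∘ ⟦ 𝓔 ⟧ᶜˣ
  ⟦ snd 𝓔 ⟧ᶜˣ      = (ηˢ ∘ proj₂) †ˢ ∘ ⟦ 𝓔 ⟧ᶜˣ
  ⟦ appˡ 𝓔 N ⟧ᶜˣ   = callᴷ 𝒮⟦ N ⟧₀ †ˢ ∘ ⟦ 𝓔 ⟧ᶜˣ
  ⟦ appʳ M 𝓔 ⟧ᶜˣ   = bodyᴷ M †ˢ ∘ ⟦ 𝓔 ⟧ᶜˣ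

  ⟦⟧ᶜᵃ-hom : ∀ {b} (A : ArgsCxt bs b) → IsHom ⟦ A ⟧ᶜᵃ
  ⟦⟧ᶜᵃ-hom (hole Ms) = †ˢ-hom _
  ⟦⟧ᶜᵃ-hom (c ∷ A)   = ∘-hom (†ˢ-hom _) (⟦⟧ᶜᵃ-hom A)

  ⟦⟧ᶜˣ-hom : (𝓔 : EvCxt σ τ) → IsHom ⟦ 𝓔 ⟧ᶜˣ
  ⟦⟧ᶜˣ-hom □            = id-hom
  ⟦⟧ᶜˣ-hom (fun f A 𝓔)  = ∘-hom (†ˢ-hom _) (∘-hom (⟦⟧ᶜᵃ-hom A) (⟦⟧ᶜˣ-hom 𝓔))
  ⟦⟧ᶜˣ-hom (cond 𝓔 M N) = ∘-hom (†ˢ-hom _) (⟦⟧ᶜˣ-hom 𝓔)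
  ⟦⟧ᶜˣ-hom (𝓔 · M)      = ∘-hom (†ˢ-hom _) (⟦⟧ᶜˣ-hom 𝓔)
  ⟦⟧ᶜˣ-hom ⟨ 𝓔 , N ⟩ˡ   = ∘-hom (†ˢ-hom _) (⟦⟧ᶜˣ-hom 𝓔)
  ⟦⟧ᶜˣ-hom ⟨ V , 𝓔 ⟩ʳ   = ∘-hom (†ˢ-hom _) (⟦⟧ᶜˣ-hom 𝓔)
  ⟦⟧ᶜˣ-hom (fst 𝓔)      = ∘-hom (†ˢ-hom _) (⟦⟧ᶜˣ-hom 𝓔)
  ⟦⟧ᶜˣ-hom (snd 𝓔)      = ∘-hom (†ˢ-hom _) (⟦⟧ᶜˣ-hom 𝓔)
  ⟦⟧ᶜˣ-hom (appˡ 𝓔 N)   = ∘-hom (†ˢ-hom _) (⟦⟧ᶜˣ-hom 𝓔)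
  ⟦⟧ᶜˣ-hom (appʳ M 𝓔)   = ∘-hom (†ˢ-hom _) (⟦⟧ᶜˣ-hom 𝓔)

  𝒮-fillArgs : ∀ {b} (A : ArgsCxt bs b) M → 𝒮⟦ fillArgs A M ⟧ᵃ [] ≡ ⟦ A ⟧ᶜᵃ 𝒮⟦ M ⟧₀
  𝒮-fillArgs (hole Ms) M = refl
  𝒮-fillArgs (c ∷ A)   M = trans (†ˢ-ηˢ (consᴷ (𝒮⟦ fillArgs A M ⟧ᵃ [])) ⟦ c ⟧ᶜ)
                                 (cong (consʳᴷ ⟦ c ⟧ᶜ †ˢ) (𝒮-fillArgs A M))

  -- Most cases are congruences; those with a value to the left of the hole use the unit law to feed
  -- it to its continuation.
  𝒮-⟦⟧ : (𝓔 : EvCxt σ τ) (Q : Program σ) → 𝒮⟦ 𝓔 ⟦ Q ⟧ ⟧₀ ≡ ⟦ 𝓔 ⟧ᶜˣ 𝒮⟦ Q ⟧₀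
  𝒮-⟦⟧ □            Q = refl
  𝒮-⟦⟧ (fun f A 𝓔)  Q =
    cong (applyᴷ f †ˢ) (trans (𝒮-fillArgs A (𝓔 ⟦ Q ⟧)) (cong ⟦ A ⟧ᶜᵃ (𝒮-⟦⟧ 𝓔 Q)))
  𝒮-⟦⟧ (cond 𝓔 M N) Q = cong (branchᴷ 𝒮⟦ M ⟧₀ 𝒮⟦ N ⟧₀ †ˢ) (𝒮-⟦⟧ 𝓔 Q)
  𝒮-⟦⟧ (𝓔 · M)      Q = cong ((_·ˢ 𝒮⟦ M ⟧₀) †ˢ) (𝒮-⟦⟧ 𝓔 Q)
  𝒮-⟦⟧ ⟨ 𝓔 , N ⟩ˡ   Q = cong (pairᴷ 𝒮⟦ N ⟧₀ †ˢ) (𝒮-⟦⟧ 𝓔 Q)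
  𝒮-⟦⟧ ⟨ V , 𝓔 ⟩ʳ   Q = trans (†ˢ-return (pairᴷ 𝒮⟦ 𝓔 ⟦ Q ⟧ ⟧₀) (𝒮-⌜⌝ V))
                              (cong (pairʳᴷ 𝒮ₚ⟦ V ⟧ †ˢ) (𝒮-⟦⟧ 𝓔 Q))
  𝒮-⟦⟧ (fst 𝓔)      Q = cong ((ηˢ ∘ proj₁) †ˢ) (𝒮-⟦⟧ 𝓔 Q)
  𝒮-⟦⟧ (snd 𝓔)      Q = cong ((ηˢ ∘ proj₂) †ˢ) (𝒮-⟦⟧ 𝓔 Q)
  𝒮-⟦⟧ (appˡ 𝓔 N)   Q = cong (callᴷ 𝒮⟦ N ⟧₀ †ˢ) (𝒮-⟦⟧ 𝓔 Q)
  𝒮-⟦⟧ (appʳ M 𝓔)   Q = trans (†ˢ-ηˢ (callᴷ 𝒮⟦ 𝓔 ⟦ Q ⟧ ⟧₀) (bodyᴷ M))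
                              (cong (bodyᴷ M †ˢ) (𝒮-⟦⟧ 𝓔 Q))

  -- Soundness of evaluation to effect values.

  𝒮⟦_⟧ᴱ : EffVal σ → S 𝒮⟦ σ ⟧ᵗ
  𝒮⟦ val V ⟧ᴱ      = ηˢ 𝒮ₚ⟦ V ⟧
  𝒮⟦ E or F ⟧ᴱ     = 𝒮⟦ E ⟧ᴱ orˢ 𝒮⟦ F ⟧ᴱ
  𝒮⟦ c · E ⟧ᴱ      = ⟦ c ⟧ᶜ ·ˢ 𝒮⟦ E ⟧ᴱ
  𝒮⟦ E +⟨ p ⟩ F ⟧ᴱ = 𝒮⟦ E ⟧ᴱ +⟨ p ⟩ˢ 𝒮⟦ F ⟧ᴱ

  -- In each effect rule the context is read as a homomorphism, moved inside the operation and read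
  -- back as a program.
  ⇓-sound : {M : Program σ} {E : EffVal σ} → M ⇓ E → 𝒮⟦ M ⟧₀ ≡ 𝒮⟦ E ⟧ᴱ
  ⇓-sound (⇓-val V) = 𝒮-⌜⌝ V
  ⇓-sound (⇓-step {E = E} (cxt 𝓔 {Q} {Q′} r) d) = begin
    𝒮⟦ 𝓔 ⟦ Q ⟧ ⟧₀      ≡⟨ 𝒮-⟦⟧ 𝓔 Q ⟩
    ⟦ 𝓔 ⟧ᶜˣ 𝒮⟦ Q ⟧₀    ≡⟨ cong ⟦ 𝓔 ⟧ᶜˣ (⟶ᵣ-sound r) ⟩
    ⟦ 𝓔 ⟧ᶜˣ 𝒮⟦ Q′ ⟧₀   ≡⟨ 𝒮-⟦⟧ 𝓔 Q′ ⟨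
    𝒮⟦ 𝓔 ⟦ Q′ ⟧ ⟧₀     ≡⟨ ⇓-sound d ⟩
    𝒮⟦ E ⟧ᴱ            ∎
  ⇓-sound (⇓-or 𝓔 {M} {N} {E} {F} d e) = begin
    𝒮⟦ 𝓔 ⟦ M or N ⟧ ⟧₀                   ≡⟨ 𝒮-⟦⟧ 𝓔 (M or N) ⟩
    ⟦ 𝓔 ⟧ᶜˣ (𝒮⟦ M ⟧₀ orˢ 𝒮⟦ N ⟧₀)        ≡⟨ hom-or (⟦⟧ᶜˣ-hom 𝓔) _ _ ⟩
    ⟦ 𝓔 ⟧ᶜˣ 𝒮⟦ M ⟧₀ orˢ ⟦ 𝓔 ⟧ᶜˣ 𝒮⟦ N ⟧₀  ≡⟨ cong₂ _orˢ_ (𝒮-⟦⟧ 𝓔 M) (𝒮-⟦⟧ 𝓔 N) ⟨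
    𝒮⟦ 𝓔 ⟦ M ⟧ ⟧₀ orˢ 𝒮⟦ 𝓔 ⟦ N ⟧ ⟧₀      ≡⟨ cong₂ _orˢ_ (⇓-sound d) (⇓-sound e) ⟩
    𝒮⟦ E ⟧ᴱ orˢ 𝒮⟦ F ⟧ᴱ                  ∎
  ⇓-sound (⇓-+ 𝓔 {M} {N} {p} {E} {F} d e) = begin
    𝒮⟦ 𝓔 ⟦ M +⟨ p ⟩ N ⟧ ⟧₀                     ≡⟨ 𝒮-⟦⟧ 𝓔 (M +⟨ p ⟩ N) ⟩
    ⟦ 𝓔 ⟧ᶜˣ (𝒮⟦ M ⟧₀ +⟨ p ⟩ˢ 𝒮⟦ N ⟧₀)          ≡⟨ hom-+ (⟦⟧ᶜˣ-hom 𝓔) _ p _ ⟩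
    ⟦ 𝓔 ⟧ᶜˣ 𝒮⟦ M ⟧₀ +⟨ p ⟩ˢ ⟦ 𝓔 ⟧ᶜˣ 𝒮⟦ N ⟧₀    ≡⟨ cong₂ (_+⟨ p ⟩ˢ_) (𝒮-⟦⟧ 𝓔 M) (𝒮-⟦⟧ 𝓔 N) ⟨
    𝒮⟦ 𝓔 ⟦ M ⟧ ⟧₀ +⟨ p ⟩ˢ 𝒮⟦ 𝓔 ⟦ N ⟧ ⟧₀        ≡⟨ cong₂ (_+⟨ p ⟩ˢ_) (⇓-sound d) (⇓-sound e) ⟩
    𝒮⟦ E ⟧ᴱ +⟨ p ⟩ˢ 𝒮⟦ F ⟧ᴱ                    ∎
  ⇓-sound (⇓-· 𝓔 {c} {M} {E} d) = begin
    𝒮⟦ 𝓔 ⟦ con c · M ⟧ ⟧₀          ≡⟨ 𝒮-⟦⟧ 𝓔 (con c · M) ⟩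
    ⟦ 𝓔 ⟧ᶜˣ 𝒮⟦ con c · M ⟧₀        ≡⟨ cong ⟦ 𝓔 ⟧ᶜˣ (†ˢ-ηˢ (_·ˢ 𝒮⟦ M ⟧₀) ⟦ c ⟧ᶜ) ⟩
    ⟦ 𝓔 ⟧ᶜˣ (⟦ c ⟧ᶜ ·ˢ 𝒮⟦ M ⟧₀)    ≡⟨ hom-· (⟦⟧ᶜˣ-hom 𝓔) _ _ ⟩
    ⟦ c ⟧ᶜ ·ˢ ⟦ 𝓔 ⟧ᶜˣ 𝒮⟦ M ⟧₀      ≡⟨ cong (⟦ c ⟧ᶜ ·ˢ_) (𝒮-⟦⟧ 𝓔 M) ⟨
    ⟦ c ⟧ᶜ ·ˢ 𝒮⟦ 𝓔 ⟦ M ⟧ ⟧₀        ≡⟨ cong (⟦ c ⟧ᶜ ·ˢ_) (⇓-sound d) ⟩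
    ⟦ c ⟧ᶜ ·ˢ 𝒮⟦ E ⟧ᴱ              ∎

  -- Effect values under the zero reward function.

  module _ {X : Set} where
    open IsBarycentricModule (isModule {X}) public using (·-identity; ·-action; ·-distrib)
      renaming (isBarycentric to isBarycentricᵀ)

  0ᴾ : X → R
  0ᴾ _ = 0ᴿ

  -- Taking rewards commutes with convex combinations by `+-algebraic` and `α-+`, and a value that
  -- itself earns 0 contributes just its accumulated reward.
  α-⟦⟧ᵀ : (μ : DW (Val σ)) → α (mapᵀ 0ᴾ ⟦ μ ⟧ᵀ) ≡ 𝐄 μ
  α-⟦⟧ᵀ μ = begin
    α (mapᵀ 0ᴾ ⟦ μ ⟧ᵀ)
      ≡⟨ ∑-hom (α ∘ mapᵀ 0ᴾ)
               (λ p u v → trans (cong α (+-algebraic _ p u v)) (α-+ p _ _)) μ _ ⟩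
    ∑ _+⟨_⟩ᴿ_ μ (λ (r , V) → α (mapᵀ 0ᴾ (r ·ᵀ η 𝒮ₚ⟦ V ⟧)))
      ≡⟨ ∑-cong μ (λ (r , V) → α-return r 𝒮ₚ⟦ V ⟧) ⟩
    𝐄 μ
      ∎
    where
    α-return : ∀ r (x : X) → α (mapᵀ 0ᴾ (r ·ᵀ η x)) ≡ r
    α-return r x = begin
      α (mapᵀ 0ᴾ (r ·ᵀ η x))   ≡⟨ cong α (·-algebraic _ r (η x)) ⟩
      α (r ·ᵀ mapᵀ 0ᴾ (η x))   ≡⟨ α-· r _ ⟩
      r +ᴿ α (mapᵀ 0ᴾ (η x))   ≡⟨ cong (λ u → r +ᴿ α u) (†-η _ x) ⟩
      r +ᴿ α (η 0ᴿ)            ≡⟨ cong (r +ᴿ_) (α-η 0ᴿ) ⟩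
      r +ᴿ 0ᴿ                  ≡⟨ +ᴿ-identityʳ r ⟩
      r                        ∎

  ⟦⟧ᵀ-·ᴰ : ∀ r (μ : DW (Val σ)) → ⟦ r ·ᴰ μ ⟧ᵀ ≡ r ·ᵀ ⟦ μ ⟧ᵀ
  ⟦⟧ᵀ-·ᴰ r μ = begin
    ⟦ r ·ᴰ μ ⟧ᵀ
      ≡⟨ ∑-mapᴰ _ μ _ ⟩
    ∑ _+⟨_⟩ᵀ_ μ (λ (s , V) → (r +ᴿ s) ·ᵀ η 𝒮ₚ⟦ V ⟧)
      ≡⟨ ∑-cong μ (λ (s , V) → ·-action r s _) ⟨
    ∑ _+⟨_⟩ᵀ_ μ (λ (s , V) → r ·ᵀ (s ·ᵀ η 𝒮ₚ⟦ V ⟧))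
      ≡⟨ ∑-hom (r ·ᵀ_) (λ p u v → ·-distrib r u p v) μ _ ⟨
    r ·ᵀ ⟦ μ ⟧ᵀ
      ∎

  𝒮ᴱ-adequate : (E : EffVal σ) → 𝒮⟦ E ⟧ᴱ 0ᴾ ≡ ⟦ Out E (s-opt E) ⟧ᵀ
  -- `Out` gives the value with accumulated reward `0ᴿ`, which acts as the identity.
  𝒮ᴱ-adequate (val V) = sym (·-identity _)
  𝒮ᴱ-adequate (E or F) = begin
    (𝒮⟦ E ⟧ᴱ orˢ 𝒮⟦ F ⟧ᴱ) 0ᴾ
      -- The induction hypotheses rewrite the branches and the test together, as the rewards
      -- compared are those of the branches.
      ≡⟨ cong₂ (λ u v → if does (α (mapᵀ 0ᴾ v) ≤ᴿ? α (mapᵀ 0ᴾ u)) then u else v)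
               (𝒮ᴱ-adequate E) (𝒮ᴱ-adequate F) ⟩
    (if does (α (mapᵀ 0ᴾ ⟦ ν ⟧ᵀ) ≤ᴿ? α (mapᵀ 0ᴾ ⟦ μ ⟧ᵀ)) then ⟦ μ ⟧ᵀ else ⟦ ν ⟧ᵀ)
      ≡⟨ cong₂ (λ r s → if does (r ≤ᴿ? s) then ⟦ μ ⟧ᵀ else ⟦ ν ⟧ᵀ) (α-⟦⟧ᵀ ν) (α-⟦⟧ᵀ μ) ⟩
    (if does (𝐄 ν ≤ᴿ? 𝐄 μ) then ⟦ μ ⟧ᵀ else ⟦ ν ⟧ᵀ)
      ≡⟨ if-float ⟦_⟧ᵀ (does (𝐄 ν ≤ᴿ? 𝐄 μ)) ⟨
    ⟦ if does (𝐄 ν ≤ᴿ? 𝐄 μ) then μ else ν ⟧ᵀ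
      ≡⟨ cong ⟦_⟧ᵀ (Out-or E F) ⟨
    ⟦ Out (E or F) (s-opt (E or F)) ⟧ᵀ
      ∎
    where
    μ = Out E (s-opt E)
    ν = Out F (s-opt F)
  𝒮ᴱ-adequate (c · E) = begin
    ⟦ c ⟧ᶜ ·ᵀ 𝒮⟦ E ⟧ᴱ 0ᴾ                ≡⟨ cong (⟦ c ⟧ᶜ ·ᵀ_) (𝒮ᴱ-adequate E) ⟩
    ⟦ c ⟧ᶜ ·ᵀ ⟦ Out E (s-opt E) ⟧ᵀ      ≡⟨ ⟦⟧ᵀ-·ᴰ ⟦ c ⟧ᶜ (Out E (s-opt E)) ⟨
    ⟦ Out (c · E) (s-opt E) ⟧ᵀ          ≡⟨ cong (λ s → ⟦ Out (c · E) s ⟧ᵀ) (s-opt-· c E) ⟨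
    ⟦ Out (c · E) (s-opt (c · E)) ⟧ᵀ    ∎
  𝒮ᴱ-adequate (E +⟨ p ⟩ F) =
    trans (cong₂ (_+⟨ p ⟩ᵀ_) (𝒮ᴱ-adequate E) (𝒮ᴱ-adequate F))
          (sym (∑-Out-+ isBarycentricᵀ E F p _
                        (s-opt-least (E +⟨ p ⟩ F)) (s-opt-least E) (s-opt-least F)))

theorem5p10 : Extensionality 0ℓ 0ℓ →
    {ℜ : Reals} {Sg : Signature ℜ} {ℛ : Rewards ℜ}
    (I : Interpretation Sg ℛ) (𝕋 : AuxMonad ℛ) →
    let open Language Sg
        open Rewards ℛ using (0ᴿ)
        open Selection I
        open Denotation I 𝕋
    in (σ : Type) (M : Program σ) → 𝒮⟦ M ⟧₀ (λ _ → 0ᴿ) ≡ ⟦ Opₛ M ⟧ᵀ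
theorem5p10 ext I 𝕋 σ M =
  -- Soundness holds at every reward function; only here is it specialised to zero.
  trans (cong (λ F → F 0ᴾ) (⇓-sound (proj₂ (Normalisation.⇓-total I M))))
        (𝒮ᴱ-adequate (Selection.Op I M))
  where open Adequacy ext I 𝕋
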